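{- Let $G$ be a finite connected nonbipartite graph (loops and multiple edges allowed) that is regular of degree $q+1\geq 3$. Then there exist a constant $C_G>0$ and a number $\beta\in[q^{ -1/2},1)$, both depending only on $G$, such that for every function $f:V\to\mathbb{R}$ on the vertices of $G$, every geodesic $\gamma=(\ldots,v_{ -2},v_{ -1},v_0,v_1,v_2,\ldots)$ in the universal cover $\widetilde{G}$ and every integer $r\geq 0$, $$\Big|\frac{1}{|\mathcal{H}_{\gamma,r}(v_0)|}\sum_{v\in\mathcal{H}_{\gamma,r}(v_0)}\tilde f(v)-\frac{1}{|V|}\sum_{v\in V}f(v)\Big|\leq C_G\,\|f\|_2\,\beta^r .$$
   Context: $G$ is a graph with vertex set $V$ and edge set $E$; a loop at a vertex contributes $2$ to its degree. The universal cover $\widetilde{G}$ of $G$ is the tree, with vertex set $\widetilde{V}$ and edge set $\widetilde{E}$, constructed as follows: fix a root vertex of $G$; the vertices of $\widetilde{G}$ are the non-backtracking paths in $G$ starting at the root (each edge, including each loop, may be traversed in two mutually inverse directions, and a path is non-backtracking if no step is immediately followed by its inverse); two such paths are neighbours if they differ by exactly one edge at the end. The projection $\pi:\widetilde{G}\to G$ sends a path to its terminal vertex. The lift of $f:V\to\mathbb{R}$ is $\tilde f=f\circ\pi:\widetilde{V}\to\mathbb{R}$, and $\|f\|_2=\big(\sum_{v\in V}f(v)^2\big)^{1/2}$. Let $\delta$ be the combinatorial distance on $\widetilde{G}$ and $S_r(x)=\{v\in\widetilde{V}:\delta(v,x)=r\}$. A geodesic $\gamma$ on the tree $\widetilde{G}$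 is a bi-infinite non-backtracking path, given by vertices $v_i\in\widetilde{V}$ ($i\in\mathbb{Z}$) with $v_i$ adjacent to $v_{i+1}$ and $v_i\neq v_{i+2}$ for all $i\in\mathbb{Z}$. The Busemann function is $b_{\gamma,v_k}(w)=\lim_{n\to\infty}\big(\delta(w,v_{k+n})-n\big)$ for $w\in\widetilde{V}$. For $k\in\mathbb{Z}$ the horocycle is $H_k=b_{\gamma,v_0}^{ -1}(k)\subset\widetilde{V}$. Define the subset of the horocycle $H_0$ $$\mathcal{H}_{\gamma,r}(v_0)=H_0\cap S_r(v_r).$$ -}

module Defs where

open import Data.Bool using (Bool; true; false; not)
open import Data.Fin using (Fin)
import Data.Fin.Properties as Fin
open import Data.Integer using (ℤ; +_)
import Data.Integer as ℤ
import Data.Integer.Properties as ℤ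
open import Data.List using (List; []; _∷_; length; map; filter; foldr; head; allFin; cartesianProduct)
open import Data.List.Membership.Propositional using (_∈_)
open import Data.List.Relation.Unary.Unique.Propositional using (Unique)
import Data.Maybe.Relation.Unary.All as Maybe
open import Data.Nat using (ℕ; zero; suc)
import Data.Nat as ℕ
import Data.Nat.Properties as ℕ
open import Data.Product using (Σ; ∃; _×_; _,_; proj₁; proj₂)
open import Data.Rational using (ℚ; mkℚ; 0ℚ; 1ℚ; ½; _+_; _*_; _-_; -_; _/_; 1/_; ∣_∣; _≤_; _<_; _⊔_; _≤?_; toℚᵘ; positive; nonNegative; NonZero)
open import Data.Rational.Properties
import Data.Rational.Unnormalised as ℚᵘ
import Data.Rational.Unnormalised.Properties as ℚᵘ
open import Data.Rational.Solver using (module +-*-Solver)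
open import Data.Sum using (_⊎_; inj₁; inj₂)
open import Data.Unit using (⊤)
open import Function using (_∘_; _⇔_)
open import Level using (0ℓ)
open import Relation.Binary using (Rel)
open import Relation.Binary.Construct.Closure.ReflexiveTransitive using (Star; fold)
open import Relation.Binary.PropositionalEquality using (_≡_; _≢_; refl; sym; trans; cong; cong₂; subst; subst₂)
open import Relation.Nullary using (yes; no)

½^_ : ℕ → ℚ
½^ zero  = 1ℚ
½^ suc n = ½ * ½^ n

module ℚ-Facts where

  ½-pos : ∀ {ε} → 0ℚ < ε → 0ℚ < ½ * ε
  ½-pos {ε} 0<ε = subst (_< ½ * ε) (*-zeroʳ ½) (*-monoʳ-<-pos ½ 0<ε)

  halves : ∀ ε → ½ * ε + ½ * ε ≡ ε
  halves ε = trans (sym (*-distribʳ-+ ε ½ ½)) (*-identityˡ ε)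

  *-pos : ∀ {p q} → 0ℚ < p → 0ℚ < q → 0ℚ < p * q
  *-pos {p} {q} 0<p 0<q =
    subst (_< p * q) (*-zeroʳ p) (*-monoʳ-<-pos p {{positive 0<p}} 0<q)

  *-nonNeg : ∀ {p q} → 0ℚ ≤ p → 0ℚ ≤ q → 0ℚ ≤ p * q
  *-nonNeg {p} {q} 0≤p 0≤q =
    subst (_≤ p * q) (*-zeroʳ p) (*-monoˡ-≤-nonNeg p {{nonNegative 0≤p}} 0≤q)

  *-mono-≤ : ∀ {p q r s} → 0ℚ ≤ q → 0ℚ ≤ r → p ≤ q → r ≤ s → p * r ≤ q * s
  *-mono-≤ {p} {q} {r} {s} 0≤q 0≤r p≤q r≤s = ≤-trans
    (*-monoʳ-≤-nonNeg r {{nonNegative 0≤r}} p≤q)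
    (*-monoˡ-≤-nonNeg q {{nonNegative 0≤q}} r≤s)

  p≤∣p∣ : ∀ p → p ≤ ∣ p ∣
  p≤∣p∣ p with ≤-total 0ℚ p
  ... | inj₁ 0≤p = ≤-reflexive (sym (0≤p⇒∣p∣≡p 0≤p))
  ... | inj₂ p≤0 = ≤-trans p≤0 (0≤∣p∣ p)

  ∣p-q∣≡∣q-p∣ : ∀ p q → ∣ p - q ∣ ≡ ∣ q - p ∣
  ∣p-q∣≡∣q-p∣ p q = trans (sym (∣-p∣≡∣p∣ (p - q)))
    (cong ∣_∣ (solve 2 (λ p q → :- (p :- q) := q :- p) refl p q))
    where
    open +-*-Solver

  below : ∀ p q {ε} → ∣ p - q ∣ < ε → p < q + ε
  below p q ∣p-q∣<ε = subst (_< _)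
    (solve 2 (λ p q → q :+ (p :- q) := p) refl p q)
    (+-monoʳ-< q (≤-<-trans (p≤∣p∣ (p - q)) ∣p-q∣<ε))
    where
    open +-*-Solver

  close : ∀ p q {ε} → p < q + ε → q < p + ε → ∣ p - q ∣ < ε
  close p q {ε} p<q+ε q<p+ε with ∣p∣≡p∨∣p∣≡-p (p - q)
  ... | inj₁ eq = subst₂ _<_ (sym eq)
        (solve 2 (λ q ε → (q :+ ε) :- q := ε) refl q ε) (+-monoˡ-< (- q) p<q+ε)
    where
    open +-*-Solver
  ... | inj₂ eq = subst₂ _<_
        (trans (solve 2 (λ p q → q :- p := :- (p :- q)) refl p q) (sym eq))
        (solve 2 (λ p ε → (p :+ ε) :- p := ε) refl p ε) (+-monoˡ-< (- p) q<p+ε)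
    where
    open +-*-Solver

  toℚᵘ-ι : ∀ k → toℚᵘ (+ k / 1) ℚᵘ.≃ ℚᵘ.mkℚᵘ (+ k) 0
  toℚᵘ-ι k = toℚᵘ-fromℚᵘ (ℚᵘ.mkℚᵘ (+ k) 0)

  ι-suc : ∀ k → + suc k / 1 ≡ 1ℚ + + k / 1
  ι-suc k = toℚᵘ-injective (ℚᵘ.≃-trans (toℚᵘ-ι (suc k)) (ℚᵘ.≃-sym
    (ℚᵘ.≃-trans (toℚᵘ-homo-+ 1ℚ (+ k / 1))
      (ℚᵘ.≃-trans (ℚᵘ.+-congʳ (toℚᵘ 1ℚ) (toℚᵘ-ι k))
        (ℚᵘ.*≡* (cong (λ z → (ℤ.1ℤ ℤ.+ z) ℤ.* ℤ.1ℤ) (ℤ.*-identityʳ (+ k))))))))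

  ι-mono : ∀ {k l} → k ℕ.≤ l → + k / 1 ≤ + l / 1
  ι-mono {k} {l} k≤l = toℚᵘ-cancel-≤
    (ℚᵘ.≤-respˡ-≃ (ℚᵘ.≃-sym (toℚᵘ-ι k)) (ℚᵘ.≤-respʳ-≃ (ℚᵘ.≃-sym (toℚᵘ-ι l))
      (ℚᵘ.*≤* (ℤ.*-monoʳ-≤-nonNeg ℤ.1ℤ (ℤ.+≤+ k≤l)))))

  archimedean : ∀ p → ∃ λ k → p < + k / 1
  archimedean (mkℚ numerator d _) = k , toℚᵘ-cancel-<
    (ℚᵘ.<-respʳ-≃ (ℚᵘ.≃-sym (toℚᵘ-ι k)) (ℚᵘ.*<* lt))
    where
    denominator = + suc d
    k = suc (ℤ.∣ numerator ∣)
    n≤∣n∣ : ∀ n → n ℤ.≤ + ℤ.∣ n ∣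
    n≤∣n∣ (+ n)     = ℤ.≤-refl
    n≤∣n∣ ℤ.-[1+ n ] = ℤ.-≤+
    lt : numerator ℤ.* ℤ.1ℤ ℤ.< + k ℤ.* denominator
    lt = ℤ.≤-<-trans (ℤ.≤-reflexive (ℤ.*-identityʳ numerator))
      (ℤ.≤-<-trans (n≤∣n∣ numerator)
        (ℤ.<-≤-trans (ℤ.+<+ (ℕ.n<1+n ℤ.∣ numerator ∣))
          (subst (ℤ._≤ + k ℤ.* denominator) (ℤ.*-identityʳ (+ k))
            (ℤ.*-monoˡ-≤-nonNeg (+ k) (ℤ.+≤+ (ℕ.s≤s ℕ.z≤n))))))

  ½^-nonNeg : ∀ n → 0ℚ ≤ ½^ n
  ½^-nonNeg zero    = nonNegative⁻¹ 1ℚ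
  ½^-nonNeg (suc n) = *-nonNeg (nonNegative⁻¹ ½) (½^-nonNeg n)

  n½^n≤1 : ∀ n → (+ n / 1) * ½^ n ≤ 1ℚ
  ½^n≤1 : ∀ n → ½^ n ≤ 1ℚ
  ½^n≤1 zero    = ≤-refl
  ½^n≤1 (suc n) = *-mono-≤ {½} {1ℚ} (nonNegative⁻¹ 1ℚ) (½^-nonNeg n) ½≤1 (½^n≤1 n)
    where
    ½≤1 : ½ ≤ 1ℚ
    ½≤1 = subst (½ ≤_) (+-identityʳ 1ℚ) (≤-trans (≤-reflexive (sym (+-identityʳ ½)))
            (+-monoʳ-≤ ½ (nonNegative⁻¹ ½)))
  n½^n≤1 zero    = ≤-trans (≤-reflexive (*-zeroˡ 1ℚ)) (nonNegative⁻¹ 1ℚ)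
  n½^n≤1 (suc n) = begin
    (+ suc n / 1) * (½ * ½^ n)           ≡⟨ cong (_* (½ * ½^ n)) (ι-suc n) ⟩
    (1ℚ + + n / 1) * (½ * ½^ n)          ≡⟨ distrib (+ n / 1) (½^ n) ⟩
    ½ * ½^ n + ½ * ((+ n / 1) * ½^ n)    ≤⟨ +-mono-≤
                                              (*-monoˡ-≤-nonNeg ½ (½^n≤1 n))
                                              (*-monoˡ-≤-nonNeg ½ (n½^n≤1 n)) ⟩
    ½ * 1ℚ + ½ * 1ℚ                      ≡⟨ halves 1ℚ ⟩
    1ℚ                                   ∎
    where
    open ≤-Reasoning
    distrib : ∀ k h → (1ℚ + k) * (½ * h) ≡ ½ * h + ½ * (k * h)
    distrib k h = trans (*-distribʳ-+ (½ * h) 1ℚ k)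
      (cong₂ _+_ (*-identityˡ (½ * h)) (swap k ½ h))
      where
      swap : ∀ k a h → k * (a * h) ≡ a * (k * h)
      swap = solve 3 (λ k a h → k :* (a :* h) := a :* (k :* h)) refl
        where
        open +-*-Solver

  ½^-small : ∀ B {ε} → 0ℚ < ε → ∃ λ N → ∀ n → N ℕ.≤ n → B * ½^ n < ε
  ½^-small B {ε} 0<ε = N , small
    where
    instance _ = positive 0<ε
    instance _ = pos⇒nonZero ε
    N₀ = archimedean (B * 1/ ε)
    N = suc (proj₁ N₀)
    B<Nε : B < (+ proj₁ N₀ / 1) * ε
    B<Nε = subst (_< (+ proj₁ N₀ / 1) * ε)
      (trans (*-assoc B (1/ ε) ε) (trans (cong (B *_) (*-inverseˡ ε)) (*-identityʳ B)))
      (*-monoˡ-<-pos ε (proj₂ N₀))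
    ½^-pos : ∀ n → 0ℚ < ½^ n
    ½^-pos zero    = positive⁻¹ 1ℚ
    ½^-pos (suc n) = ½-pos (½^-pos n)
    small : ∀ n → N ℕ.≤ n → B * ½^ n < ε
    small n N≤n = begin-strict
      B * ½^ n                      <⟨ *-monoˡ-<-pos (½^ n) {{positive (½^-pos n)}} B<Nε ⟩
      (+ proj₁ N₀ / 1) * ε * ½^ n   ≤⟨ *-monoʳ-≤-nonNeg (½^ n) {{nonNegative (½^-nonNeg n)}}
                                         (*-monoʳ-≤-nonNeg ε {{nonNegative (<⇒≤ 0<ε)}}
                                           (ι-mono (ℕ.≤-trans (ℕ.n≤1+n _) N≤n))) ⟩
      (+ n / 1) * ε * ½^ n          ≡⟨ solve 3 (λ k e h → k :* e :* h := k :* h :* e)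
                                         refl (+ n / 1) ε (½^ n) ⟩
      (+ n / 1) * ½^ n * ε          ≤⟨ *-monoʳ-≤-nonNeg ε {{nonNegative (<⇒≤ 0<ε)}} (n½^n≤1 n) ⟩
      1ℚ * ε                        ≡⟨ *-identityˡ ε ⟩
      ε                             ∎
      where
      open ≤-Reasoning
      open +-*-Solver

  divide : ∀ {p q} → 0ℚ < p → 0ℚ < q → ∃ λ r → 0ℚ < r × p * r ≡ q
  divide {p} {q} 0<p 0<q = q * p⁻¹
    , *-pos 0<q (positive⁻¹ p⁻¹ {{1/pos⇒pos p {{positive 0<p}}}})
    , trans (*-comm p (q * p⁻¹)) (trans (*-assoc q p⁻¹ p)
        (trans (cong (q *_) (*-inverseˡ p {{p≢0}})) (*-identityʳ q)))
    where
    p≢0 : NonZero p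
    p≢0 = pos⇒nonZero p {{positive 0<p}}
    p⁻¹ : ℚ
    p⁻¹ = (1/ p) {{p≢0}}

  *-close : ∀ a b c d {A B α β} → 0ℚ < A → ∣ a ∣ < A → ∣ d ∣ < B →
            ∣ c - d ∣ < α → ∣ a - b ∣ < β → ∣ a * c - b * d ∣ < A * α + B * β
  *-close a b c d {A} {B} {α} {β} 0<A a<A d<B c-d a-b = begin-strict
    ∣ a * c - b * d ∣                      ≡⟨ cong ∣_∣ (shuffle a b c d) ⟩
    ∣ a * (c - d) + d * (a - b) ∣          ≤⟨ ∣p+q∣≤∣p∣+∣q∣ (a * (c - d)) (d * (a - b)) ⟩
    ∣ a * (c - d) ∣ + ∣ d * (a - b) ∣      ≡⟨ cong₂ _+_ (∣p*q∣≡∣p∣*∣q∣ a (c - d))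
                                                        (∣p*q∣≡∣p∣*∣q∣ d (a - b)) ⟩
    ∣ a ∣ * ∣ c - d ∣ + ∣ d ∣ * ∣ a - b ∣
      ≤⟨ +-mono-≤
           (*-mono-≤ (<⇒≤ 0<A) (0≤∣p∣ (c - d)) (<⇒≤ a<A) ≤-refl)
           (*-mono-≤ (≤-trans (0≤∣p∣ d) (<⇒≤ d<B)) (0≤∣p∣ (a - b)) (<⇒≤ d<B) (<⇒≤ a-b)) ⟩
    A * ∣ c - d ∣ + B * β                  <⟨ +-monoˡ-< (B * β)
                                                (*-monoʳ-<-pos A {{positive 0<A}} c-d) ⟩
    A * α + B * β                          ∎
    where
    open ≤-Reasoning
    shuffle : ∀ a b c d → a * c - b * d ≡ a * (c - d) + d * (a - b)
    shuffle = solve 4 (λ a b c d → a :* c :- b :* d := a :* (c :- d) :+ d :* (a :- b)) refl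
      where
      open +-*-Solver

open ℚ-Facts

Eventually : (ℕ → Set) → Set
Eventually P = ∃ λ N → ∀ n → N ℕ.≤ n → P n

-- Representatives of real numbers: Cauchy sequences of rationals, not
-- quotiented.  _≤ℝ_ and _<ℝ_ are invariant under equality of limits.
record ℝ : Set where
  constructor real
  field
    seq    : ℕ → ℚ
    cauchy : ∀ {ε} → 0ℚ < ε → ∃ λ N → ∀ m n → N ℕ.≤ m → N ℕ.≤ n → ∣ seq m - seq n ∣ < ε

open ℝ public

infix  4 _≤ℝ_ _<ℝ_
infixl 6 _+ℝ_ _-ℝ_
infixl 7 _*ℝ_ _÷ℝ_
infixr 8 _^ℝ_

_≤ℝ_ : ℝ → ℝ → Set
x ≤ℝ y = ∀ {ε} → 0ℚ < ε → Eventually λ n → seq x n ≤ seq y n + ε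

_<ℝ_ : ℝ → ℝ → Set
x <ℝ y = ∃ λ ε → 0ℚ < ε × Eventually λ n → seq x n + ε ≤ seq y n

fromℚ : ℚ → ℝ
fromℚ p = real (λ _ → p) λ 0<ε → 0 , λ _ _ _ _ → subst (_< _) (sym (cong ∣_∣ (+-inverseʳ p))) 0<ε

0ℝ 1ℝ : ℝ
0ℝ = fromℚ 0ℚ
1ℝ = fromℚ 1ℚ

_+ℝ_ : ℝ → ℝ → ℝ
x +ℝ y = real (λ n → seq x n + seq y n) c
  where
  c : ∀ {ε} → 0ℚ < ε → _
  c {ε} 0<ε with cauchy x (½-pos 0<ε) | cauchy y (½-pos 0<ε)
  ... | M , p | N , q = M ℕ.⊔ N , λ m n m≥ n≥ →
    subst₂ _<_ (cong ∣_∣ (shuffle (seq x m) (seq x n) (seq y m) (seq y n))) (halves ε)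
      (≤-<-trans (∣p+q∣≤∣p∣+∣q∣ (seq x m - seq x n) (seq y m - seq y n))
        (+-mono-< (p m n (ℕ.m⊔n≤o⇒m≤o M N m≥) (ℕ.m⊔n≤o⇒m≤o M N n≥))
                  (q m n (ℕ.m⊔n≤o⇒n≤o M N m≥) (ℕ.m⊔n≤o⇒n≤o M N n≥))))
    where
    shuffle : ∀ a b c d → (a - b) + (c - d) ≡ (a + c) - (b + d)
    shuffle = solve 4 (λ a b c d → (a :- b) :+ (c :- d) := (a :+ c) :- (b :+ d)) refl
      where
      open +-*-Solver

-ℝ_ : ℝ → ℝ
-ℝ x = real (λ n → - seq x n) λ 0<ε → proj₁ (cauchy x 0<ε) , λ m n m≥ n≥ →
  subst (_< _) (trans (∣p-q∣≡∣q-p∣ (seq x m) (seq x n)) (cong ∣_∣ (swap (seq x m) (seq x n))))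
    (proj₂ (cauchy x 0<ε) m n m≥ n≥)
  where
  swap : ∀ a b → b - a ≡ - a - - b
  swap = solve 2 (λ a b → b :- a := :- a :- :- b) refl
    where
    open +-*-Solver

_-ℝ_ : ℝ → ℝ → ℝ
x -ℝ y = x +ℝ (-ℝ y)

module Bounded where

  bounded : ∀ x → ∃ λ B → 0ℚ < B × Eventually λ n → ∣ seq x n ∣ < B
  bounded x with cauchy x (positive⁻¹ 1ℚ)
  ... | N , p = ∣ seq x N ∣ + 1ℚ
    , +-mono-≤-< (0≤∣p∣ (seq x N)) (positive⁻¹ 1ℚ)
    , N , λ n n≥ → ≤-<-trans (split (seq x n) (seq x N))
        (+-monoʳ-< ∣ seq x N ∣ (p n N n≥ ℕ.≤-refl))
    where
    split : ∀ a b → ∣ a ∣ ≤ ∣ b ∣ + ∣ a - b ∣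
    split a b = subst (λ z → ∣ z ∣ ≤ ∣ b ∣ + ∣ a - b ∣)
      (solve 2 (λ a b → b :+ (a :- b) := a) refl a b) (∣p+q∣≤∣p∣+∣q∣ b (a - b))
      where
      open +-*-Solver

open Bounded

_*ℝ_ : ℝ → ℝ → ℝ
x *ℝ y = real (λ n → seq x n * seq y n) c
  where
  c : ∀ {ε} → 0ℚ < ε → ∃ λ N → ∀ m n → N ℕ.≤ m → N ℕ.≤ n →
      ∣ seq x m * seq y m - seq x n * seq y n ∣ < ε
  c {ε} 0<ε =
    let A , 0<A , M , x<A = bounded x
        B , 0<B , N , y<B = bounded y
        α , 0<α , Aα = divide 0<A (½-pos 0<ε)
        β , 0<β , Bβ = divide 0<B (½-pos 0<ε)
        X , x-close = cauchy x 0<β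
        Y , y-close = cauchy y 0<α
        K = (M ℕ.⊔ N) ℕ.⊔ (X ℕ.⊔ Y)
        M⊔N≤ = λ n (n≥ : K ℕ.≤ n) → ℕ.m⊔n≤o⇒m≤o (M ℕ.⊔ N) (X ℕ.⊔ Y) n≥
        X⊔Y≤ = λ n (n≥ : K ℕ.≤ n) → ℕ.m⊔n≤o⇒n≤o (M ℕ.⊔ N) (X ℕ.⊔ Y) n≥
    in K , λ m n m≥ n≥ →
      subst (∣ seq x m * seq y m - seq x n * seq y n ∣ <_)
        (trans (cong₂ _+_ Aα Bβ) (halves ε))
        (*-close (seq x m) (seq x n) (seq y m) (seq y n) 0<A
          (x<A m (ℕ.m⊔n≤o⇒m≤o M N (M⊔N≤ m m≥)))
          (y<B n (ℕ.m⊔n≤o⇒n≤o M N (M⊔N≤ n n≥)))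
          (y-close m n (ℕ.m⊔n≤o⇒n≤o X Y (X⊔Y≤ m m≥)) (ℕ.m⊔n≤o⇒n≤o X Y (X⊔Y≤ n n≥)))
          (x-close m n (ℕ.m⊔n≤o⇒m≤o X Y (X⊔Y≤ m m≥)) (ℕ.m⊔n≤o⇒m≤o X Y (X⊔Y≤ n n≥))))

_÷ℝ_ : ℝ → (n : ℕ) .{{_ : ℕ.NonZero n}} → ℝ
x ÷ℝ n = x *ℝ fromℚ (+ 1 / n)

_^ℝ_ : ℝ → ℕ → ℝ
x ^ℝ zero  = 1ℝ
x ^ℝ suc n = x *ℝ x ^ℝ n

∣_∣ℝ : ℝ → ℝ
∣ x ∣ℝ = real (λ n → ∣ seq x n ∣) λ 0<ε → proj₁ (cauchy x 0<ε) , λ m n m≥ n≥ →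
  close ∣ seq x m ∣ ∣ seq x n ∣
    (≤-<-trans (split (seq x m) (seq x n))
      (+-monoʳ-< ∣ seq x n ∣ (proj₂ (cauchy x 0<ε) m n m≥ n≥)))
    (≤-<-trans (split (seq x n) (seq x m))
      (+-monoʳ-< ∣ seq x m ∣ (proj₂ (cauchy x 0<ε) n m n≥ m≥)))
  where
  split : ∀ a b → ∣ a ∣ ≤ ∣ b ∣ + ∣ a - b ∣
  split a b = subst (λ z → ∣ z ∣ ≤ ∣ b ∣ + ∣ a - b ∣)
    (solve 2 (λ a b → b :+ (a :- b) := a) refl a b) (∣p+q∣≤∣p∣+∣q∣ b (a - b))
    where
    open +-*-Solver

-- Bisection: for a ≥ 0 the square root of a lies in
-- [ sqrtLow a n , sqrtLow a n + sqrtWidth a n ).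

sqrtWidth : ℚ → ℕ → ℚ
sqrtWidth a n = (1ℚ + a) * ½^ n

sqrtStep : ℚ → ℚ → ℚ → ℚ
sqrtStep a lo mid with mid * mid ≤? a
... | yes _ = mid
... | no  _ = lo

sqrtLow : ℚ → ℕ → ℚ
sqrtLow a zero    = 0ℚ
sqrtLow a (suc n) = sqrtStep a (sqrtLow a n) (sqrtLow a n + sqrtWidth a (suc n))

module SqrtFacts where

  1≤1+a : ∀ {a} → 0ℚ ≤ a → 1ℚ ≤ 1ℚ + a
  1≤1+a {a} 0≤a = subst (_≤ 1ℚ + a) (+-identityʳ 1ℚ) (+-monoʳ-≤ 1ℚ 0≤a)

  0≤1+a : ∀ {a} → 0ℚ ≤ a → 0ℚ ≤ 1ℚ + a
  0≤1+a 0≤a = ≤-trans (nonNegative⁻¹ 1ℚ) (1≤1+a 0≤a)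

  sqrtWidth-nonNeg : ∀ {a} → 0ℚ ≤ a → ∀ n → 0ℚ ≤ sqrtWidth a n
  sqrtWidth-nonNeg 0≤a n = *-nonNeg (0≤1+a 0≤a) (½^-nonNeg n)

  sqrtWidth-halves : ∀ a n → sqrtWidth a (suc n) + sqrtWidth a (suc n) ≡ sqrtWidth a n
  sqrtWidth-halves a n = trans (sym (*-distribˡ-+ (1ℚ + a) _ _))
    (cong ((1ℚ + a) *_) (halves (½^ n)))

open SqrtFacts

sqrt-bracket : ∀ {a} → 0ℚ ≤ a → ∀ n → let lo = sqrtLow a n ; hi = lo + sqrtWidth a n in
               0ℚ ≤ lo × lo * lo ≤ a × a < hi * hi
sqrt-bracket {a} 0≤a zero = ≤-refl , 0≤a , (begin-strict
  a                         ≡⟨ +-identityˡ a ⟨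
  0ℚ + a                    <⟨ +-monoˡ-< a (positive⁻¹ 1ℚ) ⟩
  1ℚ + a                    ≡⟨ *-identityʳ (1ℚ + a) ⟨
  (1ℚ + a) * 1ℚ             ≤⟨ *-monoˡ-≤-nonNeg (1ℚ + a) {{nonNegative (0≤1+a 0≤a)}} (1≤1+a 0≤a) ⟩
  (1ℚ + a) * (1ℚ + a)       ≡⟨ cong₂ _*_ eq eq ⟩
  (0ℚ + (1ℚ + a) * 1ℚ) * (0ℚ + (1ℚ + a) * 1ℚ) ∎)
  where
  open ≤-Reasoning
  eq : 1ℚ + a ≡ 0ℚ + (1ℚ + a) * 1ℚ
  eq = sym (trans (+-identityˡ ((1ℚ + a) * 1ℚ)) (*-identityʳ (1ℚ + a)))
sqrt-bracket {a} 0≤a (suc n) with sqrt-bracket 0≤a n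
... | 0≤lo , lo²≤a , a<hi²
  with (sqrtLow a n + sqrtWidth a (suc n)) * (sqrtLow a n + sqrtWidth a (suc n)) ≤? a
... | yes mid²≤a = +-mono-≤ 0≤lo (sqrtWidth-nonNeg 0≤a (suc n)) , mid²≤a ,
  subst (λ hi → a < hi * hi)
    (trans (cong (λ z → sqrtLow a n + z) (sym (sqrtWidth-halves a n)))
      (sym (+-assoc (sqrtLow a n) (sqrtWidth a (suc n)) (sqrtWidth a (suc n)))))
    a<hi²
... | no mid²≰a = 0≤lo , lo²≤a , ≰⇒> mid²≰a

-- Negative arguments are truncated to 0.
√_ : ℝ → ℝ
√ x = real s c
  where
  a : ℕ → ℚ
  a n = 0ℚ ⊔ seq x n
  0≤a : ∀ n → 0ℚ ≤ a n
  0≤a n = p≤p⊔q 0ℚ (seq x n)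
  s : ℕ → ℚ
  s n = sqrtLow (a n) n

  a-close : ∀ {m n ε} → ∣ seq x m - seq x n ∣ < ε → a m < a n + ε
  a-close {m} {n} {ε} h with ⊔-sel 0ℚ (seq x m)
  ... | inj₁ eq = subst (_< a n + ε) (sym eq)
        (+-mono-≤-< (0≤a n) (≤-<-trans (0≤∣p∣ (seq x m - seq x n)) h))
  ... | inj₂ eq = subst (_< a n + ε) (sym eq)
        (<-≤-trans (below (seq x m) (seq x n) h) (+-monoˡ-≤ ε (p≤q⊔p 0ℚ (seq x n))))

  gap : ∀ {ε} m n → 0ℚ < ε → sqrtWidth (a n) n < ½ * ε → a m < a n + (½ * ε) * (½ * ε) →
        s m < s n + ε
  gap {ε} m n 0<ε w<½ε am<an = ≰⇒> λ sn+ε≤sm → <-irrefl refl (begin-strict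
    (s n + ε) * (s n + ε)
      ≤⟨ *-mono-≤ 0≤sm 0≤sn+ε sn+ε≤sm sn+ε≤sm ⟩
    s m * s m                     ≤⟨ sm²≤am ⟩
    a m                           <⟨ am<an ⟩
    a n + η * η                   <⟨ +-monoˡ-< (η * η) an<hi² ⟩
    (s n + w) * (s n + w) + η * η
      ≤⟨ +-monoˡ-≤ (η * η) (*-mono-≤ 0≤sn+η 0≤sn+w sn+w≤sn+η sn+w≤sn+η) ⟩
    (s n + η) * (s n + η) + η * η
      ≤⟨ ≤-trans (≤-reflexive (sym (+-identityʳ _)))
           (+-monoʳ-≤ ((s n + η) * (s n + η) + η * η)
             (*-nonNeg 0≤sn+η (+-mono-≤ 0≤η 0≤η))) ⟩
    (s n + η) * (s n + η) + η * η + (s n + η) * (η + η)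
      ≡⟨ expand (s n) η ⟩
    (s n + (η + η)) * (s n + (η + η))
      ≡⟨ cong (λ z → (s n + z) * (s n + z)) (halves ε) ⟩
    (s n + ε) * (s n + ε) ∎)
    where
    open ≤-Reasoning
    η = ½ * ε
    w = sqrtWidth (a n) n
    0≤sm = proj₁ (sqrt-bracket (0≤a m) m)
    sm²≤am = proj₁ (proj₂ (sqrt-bracket (0≤a m) m))
    0≤sn = proj₁ (sqrt-bracket (0≤a n) n)
    an<hi² = proj₂ (proj₂ (sqrt-bracket (0≤a n) n))
    0≤η = <⇒≤ (½-pos 0<ε)
    0≤sn+ε = +-mono-≤ 0≤sn (<⇒≤ 0<ε)
    0≤sn+η = +-mono-≤ 0≤sn 0≤η
    0≤sn+w = +-mono-≤ 0≤sn (sqrtWidth-nonNeg (0≤a n) n)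
    sn+w≤sn+η = +-monoʳ-≤ (s n) (<⇒≤ w<½ε)
    expand : ∀ t h → (t + h) * (t + h) + h * h + (t + h) * (h + h) ≡ (t + (h + h)) * (t + (h + h))
    expand = solve 2 (λ t h → (t :+ h) :* (t :+ h) :+ h :* h :+ (t :+ h) :* (h :+ h)
               := (t :+ (h :+ h)) :* (t :+ (h :+ h))) refl
      where
      open +-*-Solver

  c : ∀ {ε} → 0ℚ < ε → ∃ λ N → ∀ m n → N ℕ.≤ m → N ℕ.≤ n → ∣ s m - s n ∣ < ε
  c {ε} 0<ε = K , λ m n m≥ n≥ → close (s m) (s n)
      (gap m n 0<ε (width n n≥) (a-close (proj₂ X m n (k₁ m≥) (k₁ n≥))))
      (gap n m 0<ε (width m m≥) (a-close (proj₂ X n m (k₁ n≥) (k₁ m≥))))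
    where
    B = proj₁ (bounded x)
    0<B = proj₁ (proj₂ (bounded x))
    L = proj₁ (proj₂ (proj₂ (bounded x)))
    x<B = proj₂ (proj₂ (proj₂ (bounded x)))
    X = cauchy x (*-pos (½-pos 0<ε) (½-pos 0<ε))
    W = ½^-small (1ℚ + B) (½-pos 0<ε)
    K = proj₁ X ℕ.⊔ (L ℕ.⊔ proj₁ W)
    k₁ : ∀ {n} → K ℕ.≤ n → proj₁ X ℕ.≤ n
    k₁ = ℕ.m⊔n≤o⇒m≤o (proj₁ X) _
    width : ∀ n → K ℕ.≤ n → sqrtWidth (a n) n < ½ * ε
    width n n≥ = ≤-<-trans
      (*-monoʳ-≤-nonNeg (½^ n) {{nonNegative (½^-nonNeg n)}} (+-monoʳ-≤ 1ℚ
        (⊔-lub (<⇒≤ 0<B) (≤-trans (p≤∣p∣ (seq x n))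
          (<⇒≤ (x<B n (ℕ.m⊔n≤o⇒m≤o L (proj₁ W) (ℕ.m⊔n≤o⇒n≤o (proj₁ X) _ n≥))))))))
      (proj₂ W n (ℕ.m⊔n≤o⇒n≤o L (proj₁ W) (ℕ.m⊔n≤o⇒n≤o (proj₁ X) _ n≥)))

sumℝ : List ℝ → ℝ
sumℝ = foldr _+ℝ_ 0ℝ

-- The order of the two ends of an edge carries no meaning.
record Graph : Set where
  field
    #V   : ℕ
    #E   : ℕ
    ends : Fin #E → Fin #V × Fin #V

  V = Fin #V
  E = Fin #E

  -- An edge with a direction of traversal; a loop gives two darts.
  Dart = E × Bool

  source target : Dart → V
  source (e , true)  = proj₁ (ends e)
  source (e , false) = proj₂ (ends e)
  target (e , b) = source (e , not b)

  inverse : Dart → Dart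
  inverse (e , b) = e , not b

  darts : List Dart
  darts = cartesianProduct (allFin #E) (true ∷ false ∷ [])

  degree : V → ℕ
  degree v = length (filter (λ d → source d Fin.≟ v) darts)

  Adjacent : Rel V 0ℓ
  Adjacent u v = ∃ λ d → source d ≡ u × target d ≡ v

  norm₂ : (V → ℝ) → ℝ
  norm₂ f = √ sumℝ (map (λ v → f v *ℝ f v) (allFin #V))

open Graph public

Connected : Graph → Set
Connected G = ∀ (u v : V G) → Star (Adjacent G) u v

Bipartite : Graph → Set
Bipartite G = ∃ λ (colour : V G → Bool) →
  ∀ e → colour (proj₁ (ends G e)) ≢ colour (proj₂ (ends G e))

Regular : Graph → ℕ → Set
Regular G k = ∀ v → degree G v ≡ k

walkLength : {A : Set} {_~_ : Rel A 0ℓ} {x y : A} → Star _~_ x y → ℕ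
walkLength = fold (λ _ _ → ℕ) (λ _ → suc) 0

IsDistance : {A : Set} (_~_ : Rel A 0ℓ) → A → A → ℕ → Set
IsDistance _~_ x y k =
  (∃ λ (w : Star _~_ x y) → walkLength w ≡ k) × (∀ (w : Star _~_ x y) → k ℕ.≤ walkLength w)

module UniversalCover (G : Graph) (root : V G) where

  -- Paths from the root, last step first.
  endpoint : List (Dart G) → V G
  endpoint []      = root
  endpoint (d ∷ _) = target G d

  IsNonBacktracking : List (Dart G) → Set
  IsNonBacktracking []       = ⊤
  IsNonBacktracking (d ∷ ds) =
    source G d ≡ endpoint ds ×
    Maybe.All (λ d′ → d ≢ inverse G d′) (head ds) ×
    IsNonBacktracking ds

  record Ṽ : Set where
    constructor path
    field
      steps              : List (Dart G)
      .isNonBacktracking : IsNonBacktracking steps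

  open Ṽ public

  infix 4 _~_ _δ≡_

  _~_ : Rel Ṽ 0ℓ
  x ~ y = ∃ λ d → steps y ≡ d ∷ steps x ⊎ steps x ≡ d ∷ steps y

  π : Ṽ → V G
  π x = endpoint (steps x)

  lift : (V G → ℝ) → Ṽ → ℝ
  lift f = f ∘ π

  -- δ(x , y) = k is written (x , y) δ≡ k.
  _δ≡_ : Ṽ × Ṽ → ℕ → Set
  (x , y) δ≡ k = IsDistance _~_ x y k

  Sphere : ℕ → Ṽ → Ṽ → Set
  Sphere r x v = (v , x) δ≡ r

  record Geodesic : Set where
    field
      vertex          : ℤ → Ṽ
      consecutive     : ∀ i → vertex i ~ vertex (i ℤ.+ + 1)
      nonBacktracking : ∀ i → vertex i ≢ vertex (i ℤ.+ + 2)

  open Geodesic public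

  -- b_{γ,v_k}(w) = c.  The integers δ(w , v_{k+n}) - n converge to c
  -- exactly when they are eventually equal to c.
  Busemann : Geodesic → ℤ → Ṽ → ℤ → Set
  Busemann γ k w c = Eventually λ n →
    ∃ λ d → (w , vertex γ (k ℤ.+ + n)) δ≡ d × + d ℤ.- + n ≡ c

  Horocycle : Geodesic → ℤ → Ṽ → Set
  Horocycle γ k w = Busemann γ (+ 0) w k

  𝓗 : Geodesic → ℕ → Ṽ → Set
  𝓗 γ r v = Horocycle γ (+ 0) v × Sphere r (vertex γ (+ r)) v

-- A listing without repetition of a finite nonempty set.
record Enumeration {A : Set} (P : A → Set) : Set where
  field
    elements   : List A
    unique     : Unique elements
    membership : ∀ x → x ∈ elements ⇔ P x
    nonEmpty   : ℕ.NonZero (length elements)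

open Enumeration public

average : {A : Set} {P : A → Set} → Enumeration P → (A → ℝ) → ℝ
average xs f = _÷ℝ_ (sumℝ (map f (elements xs))) (length (elements xs)) {{nonEmpty xs}}

-- The vertex serves only to show that V is nonempty.
averageV : (G : Graph) → V G → (V G → ℝ) → ℝ
averageV G v f = _÷ℝ_ (sumℝ (map f (allFin (#V G)))) (#V G) {{Fin.nonZeroIndex v}}

3≤q+1⇒nonZero : ∀ {q} → 3 ℕ.≤ q ℕ.+ 1 → ℕ.NonZero q
3≤q+1⇒nonZero {suc q} _ = _
3≤q+1⇒nonZero {zero} (ℕ.s≤s ())

{-# OPTIONS --safe #-}
module Submission where

-- Let B be the nonbacktracking operator on darts and g = f ∘ target.  Seen from v_r, the horocycle
-- piece consists of the endpoints of the q ^ r nonbacktracking walks of length r that continue the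
-- dart from v_{r+1} to v_r, so the average of the lift of f is q ^ -r (B ^ r g) at this dart.
--
-- Rows and columns of B sum to q, hence B preserves the functions of sum zero.  It is primitive: the
-- set S of darts reached from a given dart in exactly n steps grows with n, and can stay of the same
-- size for two steps only if S and its set of successors are both closed under having a common
-- continuation.  Then S consists of all darts into a set T of vertices, its successors of all darts
-- into a set T′, and all neighbours of T lie in T′ and conversely, so that T = T′ = V because G is
-- connected and not bipartite.  If all darts are reached in k steps, then B ^ k h ≥ ∑ h for h ≥ 0;
-- applied to M - h and M + h this gives ∣B ^ k h∣ ≤ (q ^ k - 1) M for h of sum zero with ∣h∣ ≤ M.
--
-- All bounds hold for each rational approximant of f, up to the bisection error of the norm, which
-- tends to 0.

open import Defs
open import Data.Bool using (Bool; false; not; true)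
import Data.Bool.Properties as Bool
import Data.Fin.Properties as Fin
import Data.Integer as ℤ
import Data.Integer.Properties as ℤ
open import Data.List using (List; []; _++_; _∷_; _∷ʳ_; allFin; cartesianProduct; concatMap; filter; length; map; reverse)
open import Data.Nat using (suc; s≤s; zero; z≤n; ℕ)
import Data.Nat as ℕ
import Data.Nat.Properties as ℕ
open import Data.Product using (_,_; _×_; proj₁; proj₂; ∃)
open import Data.Sum using (_⊎_; inj₁; inj₂; map₂; swap)
open import Relation.Binary using (DecidableEquality)
open import Relation.Binary.PropositionalEquality
open import Relation.Nullary hiding (T?)

-- Finite sums of rationals and indicator functions.

module Sums where

  open import Data.List.Membership.Propositional using (_∈_)
  open import Data.List.Relation.Unary.All using (lookup)
  open import Data.List.Relation.Unary.AllPairs using (_∷_)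
  open import Data.List.Relation.Unary.Any using (here; there)
  open import Data.List.Relation.Unary.Unique.Propositional using (Unique)
  open import Data.Rational
  open import Data.Rational.Properties
  open import Data.Rational.Solver using (module +-*-Solver)
  open import Relation.Unary using (Pred; Decidable)
  open +-*-Solver
  open ℚ-Facts

  ι : ℕ → ℚ
  ι n = ℤ.+ n / 1

  ∑ : {A : Set} → List A → (A → ℚ) → ℚ
  ∑ []       f = 0ℚ
  ∑ (x ∷ xs) f = f x + ∑ xs f

  𝟙 : {P : Set} → Dec P → ℚ
  𝟙 (true because _)  = 1ℚ
  𝟙 (false because _) = 0ℚ

  0≤1 : 0ℚ ≤ 1ℚ
  0≤1 = nonNegative⁻¹ 1ℚ

  p≤q⇒0≤q-p : ∀ {p q} → p ≤ q → 0ℚ ≤ q - p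
  p≤q⇒0≤q-p {p} {q} p≤q = subst (_≤ q - p) (+-inverseʳ p) (+-monoˡ-≤ (- p) p≤q)

  0≤q-p⇒p≤q : ∀ {p q} → 0ℚ ≤ q - p → p ≤ q
  0≤q-p⇒p≤q {p} {q} 0≤q-p = subst₂ _≤_ (+-identityˡ p)
    (solve 2 (λ p q → (q :- p) :+ p := q) refl p q) (+-monoˡ-≤ p 0≤q-p)

  ∣∣-lub : ∀ {p b} → p ≤ b → - p ≤ b → ∣ p ∣ ≤ b
  ∣∣-lub {p} p≤b -p≤b with ∣p∣≡p∨∣p∣≡-p p
  ... | inj₁ eq = subst (_≤ _) (sym eq) p≤b
  ... | inj₂ eq = subst (_≤ _) (sym eq) -p≤b

  -p≤∣p∣ : ∀ p → - p ≤ ∣ p ∣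
  -p≤∣p∣ p = subst (- p ≤_) (∣-p∣≡∣p∣ p) (p≤∣p∣ (- p))

  𝟙-yes : {P : Set} (P? : Dec P) → P → 𝟙 P? ≡ 1ℚ
  𝟙-yes (yes _)  _ = refl
  𝟙-yes (no ¬p) p = contradiction p ¬p

  𝟙-no : {P : Set} (P? : Dec P) → ¬ P → 𝟙 P? ≡ 0ℚ
  𝟙-no (yes p) ¬p = contradiction p ¬p
  𝟙-no (no _)  _  = refl

  0≤𝟙 : {P : Set} (P? : Dec P) → 0ℚ ≤ 𝟙 P?
  0≤𝟙 (yes _) = 0≤1
  0≤𝟙 (no _)  = ≤-refl

  𝟙≤1 : {P : Set} (P? : Dec P) → 𝟙 P? ≤ 1ℚ
  𝟙≤1 (yes _) = ≤-refl
  𝟙≤1 (no _)  = 0≤1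

  𝟙-⇔ : {P Q : Set} (P? : Dec P) (Q? : Dec Q) → (P → Q) → (Q → P) → 𝟙 P? ≡ 𝟙 Q?
  𝟙-⇔ P? (yes q) _   Q⇒P = 𝟙-yes P? (Q⇒P q)
  𝟙-⇔ P? (no ¬q) P⇒Q _   = 𝟙-no P? (λ p → ¬q (P⇒Q p))

  module _ {A : Set} where

    ∑-cong : ∀ xs {f g : A → ℚ} → (∀ x → f x ≡ g x) → ∑ xs f ≡ ∑ xs g
    ∑-cong []       _  = refl
    ∑-cong (x ∷ xs) eq = cong₂ _+_ (eq x) (∑-cong xs eq)

    ∑-mono : ∀ xs {f g : A → ℚ} → (∀ x → f x ≤ g x) → ∑ xs f ≤ ∑ xs g
    ∑-mono []       _  = ≤-refl
    ∑-mono (x ∷ xs) le = +-mono-≤ (le x) (∑-mono xs le)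

    -- A surplus `c` at a single index survives summation. With `c = 1` this makes sets of reached
    -- darts grow; with `f = 0` it bounds one term by a sum of nonnegative terms.
    ∑-gain : ∀ {xs} {f g : A → ℚ} {c x₀} → x₀ ∈ xs → (∀ x → f x ≤ g x) →
             f x₀ + c ≤ g x₀ → ∑ xs f + c ≤ ∑ xs g
    ∑-gain {x ∷ xs} {f} {g} {c} (here refl) le gain =
      subst (_≤ g x + ∑ xs g)
        (solve 3 (λ a c s → (a :+ c) :+ s := (a :+ s) :+ c) refl (f x) c (∑ xs f))
        (+-mono-≤ gain (∑-mono xs le))
    ∑-gain {x ∷ xs} {f} {g} {c} (there x₀∈) le gain =
      subst (_≤ g x + ∑ xs g) (sym (+-assoc (f x) (∑ xs f) c))
        (+-mono-≤ (le x) (∑-gain x₀∈ le gain))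

    ∑-zero : ∀ (xs : List A) → ∑ xs (λ _ → 0ℚ) ≡ 0ℚ
    ∑-zero []       = refl
    ∑-zero (_ ∷ xs) = cong (0ℚ +_) (∑-zero xs)

    ∑-nonNeg : ∀ xs {f : A → ℚ} → (∀ x → 0ℚ ≤ f x) → 0ℚ ≤ ∑ xs f
    ∑-nonNeg xs {f} 0≤f = subst (_≤ ∑ xs f) (∑-zero xs) (∑-mono xs 0≤f)

    ∑-distrib-+ : ∀ xs (f g : A → ℚ) → ∑ xs (λ x → f x + g x) ≡ ∑ xs f + ∑ xs g
    ∑-distrib-+ []       f g = refl
    ∑-distrib-+ (x ∷ xs) f g = trans (cong (f x + g x +_) (∑-distrib-+ xs f g))
      (solve 4 (λ a b s t → (a :+ b) :+ (s :+ t) := (a :+ s) :+ (b :+ t)) refl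
        (f x) (g x) (∑ xs f) (∑ xs g))

    ∑-*ˡ : ∀ xs c (f : A → ℚ) → ∑ xs (λ x → c * f x) ≡ c * ∑ xs f
    ∑-*ˡ []       c f = sym (*-zeroʳ c)
    ∑-*ˡ (x ∷ xs) c f = trans (cong (c * f x +_) (∑-*ˡ xs c f)) (sym (*-distribˡ-+ c (f x) (∑ xs f)))

    ∑-*ʳ : ∀ xs c (f : A → ℚ) → ∑ xs (λ x → f x * c) ≡ ∑ xs f * c
    ∑-*ʳ xs c f = trans (∑-cong xs (λ x → *-comm (f x) c)) (trans (∑-*ˡ xs c f) (*-comm c (∑ xs f)))

    ∑-distrib-- : ∀ xs (f g : A → ℚ) → ∑ xs (λ x → f x - g x) ≡ ∑ xs f - ∑ xs g
    ∑-distrib-- []       f g = refl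
    ∑-distrib-- (x ∷ xs) f g = trans (cong (f x - g x +_) (∑-distrib-- xs f g))
      (solve 4 (λ a b s t → (a :- b) :+ (s :- t) := (a :+ s) :- (b :+ t)) refl
        (f x) (g x) (∑ xs f) (∑ xs g))

    ∑-swap : ∀ {B : Set} xs (ys : List B) (f : A → B → ℚ) →
             ∑ xs (λ x → ∑ ys (f x)) ≡ ∑ ys (λ y → ∑ xs (λ x → f x y))
    ∑-swap []       ys f = sym (go ys)
      where
      go : ∀ {B : Set} (ys : List B) → ∑ ys (λ _ → 0ℚ) ≡ 0ℚ
      go []       = refl
      go (_ ∷ ys) = cong (0ℚ +_) (go ys)
    ∑-swap (x ∷ xs) ys f = trans (cong (∑ ys (f x) +_) (∑-swap xs ys f)) (go ys)
      where
      go : ∀ ys → ∑ ys (f x) + ∑ ys (λ y → ∑ xs (λ x → f x y)) ≡ ∑ ys (λ y → f x y + ∑ xs (λ x → f x y))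
      go []       = refl
      go (y ∷ ys) = trans
        (solve 4 (λ a b s t → (a :+ s) :+ (b :+ t) := (a :+ b) :+ (s :+ t)) refl
          (f x y) (∑ xs (λ x → f x y)) (∑ ys (f x)) (∑ ys (λ y → ∑ xs (λ x → f x y))))
        (cong (f x y + ∑ xs (λ x → f x y) +_) (go ys))

    ∑-++ : ∀ xs ys (f : A → ℚ) → ∑ (xs ++ ys) f ≡ ∑ xs f + ∑ ys f
    ∑-++ []       ys f = sym (+-identityˡ (∑ ys f))
    ∑-++ (x ∷ xs) ys f = trans (cong (f x +_) (∑-++ xs ys f)) (sym (+-assoc (f x) (∑ xs f) (∑ ys f)))

    ∑-map : ∀ {B : Set} xs (g : A → B) (f : B → ℚ) → ∑ (map g xs) f ≡ ∑ xs (λ x → f (g x))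
    ∑-map []       g f = refl
    ∑-map (x ∷ xs) g f = cong (f (g x) +_) (∑-map xs g f)

    ∑-filter : ∀ {P : Pred A _} (P? : Decidable P) xs (f : A → ℚ) →
               ∑ (filter P? xs) f ≡ ∑ xs (λ x → 𝟙 (P? x) * f x)
    ∑-filter P? []       f = refl
    ∑-filter P? (x ∷ xs) f with P? x
    ... | yes _ = cong₂ _+_ (sym (*-identityˡ (f x))) (∑-filter P? xs f)
    ... | no  _ = trans (∑-filter P? xs f) (sym (trans (cong (_+ _) (*-zeroˡ (f x))) (+-identityˡ _)))

    ∑-length : ∀ (xs : List A) → ∑ xs (λ _ → 1ℚ) ≡ ι (length xs)
    ∑-length []       = refl
    ∑-length (_ ∷ xs) = trans (cong (1ℚ +_) (∑-length xs)) (sym (ι-suc (length xs)))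

    ∣∑∣≤ : ∀ xs (f : A → ℚ) → ∣ ∑ xs f ∣ ≤ ∑ xs (λ x → ∣ f x ∣)
    ∣∑∣≤ []       f = ≤-refl
    ∣∑∣≤ (x ∷ xs) f = ≤-trans (∣p+q∣≤∣p∣+∣q∣ (f x) (∑ xs f)) (+-monoʳ-≤ ∣ f x ∣ (∣∑∣≤ xs f))

    term≤∑ : ∀ {xs} {f : A → ℚ} {x} → (∀ x → 0ℚ ≤ f x) → x ∈ xs → f x ≤ ∑ xs f
    term≤∑ {xs} {f} {x} 0≤f x∈ = subst (_≤ ∑ xs f)
      (trans (cong (_+ f x) (∑-zero xs)) (+-identityˡ (f x)))
      (∑-gain x∈ 0≤f (≤-reflexive (+-identityˡ (f x))))

    module _ (_≟_ : DecidableEquality A) where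

      ∑-pick-∉ : ∀ xs (f : A → ℚ) x → (∀ {y} → y ∈ xs → x ≢ y) → ∑ xs (λ y → 𝟙 (x ≟ y) * f y) ≡ 0ℚ
      ∑-pick-∉ []       f x x∉ = refl
      ∑-pick-∉ (y ∷ ys) f x x∉ = cong₂ _+_
        (trans (cong (_* f y) (𝟙-no (x ≟ y) (x∉ (here refl)))) (*-zeroˡ (f y)))
        (∑-pick-∉ ys f x (λ y∈ → x∉ (there y∈)))

      -- Since the list has no repetition, exactly one summand survives. Inserting such a delta
      -- allows sums over darts to be regrouped by vertices.
      ∑-pick : ∀ {xs} (f : A → ℚ) {x} → Unique xs → x ∈ xs → ∑ xs (λ y → 𝟙 (x ≟ y) * f y) ≡ f x
      ∑-pick {y ∷ ys} f (y∉ ∷ _) (here refl) = trans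
        (cong₂ _+_ (trans (cong (_* f y) (𝟙-yes (y ≟ y) refl)) (*-identityˡ (f y)))
                   (∑-pick-∉ ys f y (lookup y∉)))
        (+-identityʳ (f y))
      ∑-pick {y ∷ ys} f {x} (y∉ ∷ uniq) (there x∈) = trans
        (cong₂ _+_ (trans (cong (_* f y) (𝟙-no (x ≟ y) (λ x≡y → lookup y∉ x∈ (sym x≡y)))) (*-zeroˡ (f y)))
                   (∑-pick f uniq x∈))
        (+-identityˡ (f x))

  ∑-concatMap : ∀ {A B : Set} xs (f : A → List B) (g : B → ℚ) →
                ∑ (concatMap f xs) g ≡ ∑ xs (λ x → ∑ (f x) g)
  ∑-concatMap []       f g = refl
  ∑-concatMap (x ∷ xs) f g = trans (∑-++ (f x) (concatMap f xs) g) (cong (∑ (f x) g +_) (∑-concatMap xs f g))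

-- Darts, nonbacktracking continuation and the nonbacktracking operator.

module DartWalks (G : Graph) where

  open import Data.Bool.Properties using (not-involutive)
  open import Data.List.Membership.Propositional using (_∈_; find; lose)
  open import Data.List.Membership.Propositional.Properties using (∈-cartesianProduct⁺; ∈-allFin)
  open import Data.List.Relation.Unary.All using ([]; _∷_)
  open import Data.List.Relation.Unary.AllPairs using ([]; _∷_)
  open import Data.List.Relation.Unary.Any using (here; there; any?)
  open import Data.List.Relation.Unary.Unique.Propositional using (Unique)
  open import Data.List.Relation.Unary.Unique.Propositional.Properties using (cartesianProduct⁺; allFin⁺)
  open import Data.Product.Properties using (≡-dec)
  open import Data.Rational
  open import Data.Rational.Properties
  open import Data.Rational.Solver using (module +-*-Solver)
  open import Relation.Unary using (Decidable)
  open +-*-Solver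
  open Sums

  infix 4 _⟶_ _⟶?_ _≟ᴰ_

  _≟ᴰ_ : DecidableEquality (Dart G)
  _≟ᴰ_ = ≡-dec Fin._≟_ Bool._≟_

  -- A loop dart may follow itself; only the opposite traversal of the same edge is excluded.
  _⟶_ : Dart G → Dart G → Set
  d ⟶ e = target G d ≡ source G e × e ≢ inverse G d

  _⟶?_ : ∀ d e → Dec (d ⟶ e)
  d ⟶? e = (target G d Fin.≟ source G e) ×-dec ¬? (e ≟ᴰ inverse G d)

  ∈-darts : ∀ d → d ∈ darts G
  ∈-darts (e , b) = ∈-cartesianProduct⁺ (∈-allFin e) (∈-bools b)
    where
    ∈-bools : ∀ b → b ∈ true ∷ false ∷ []
    ∈-bools true  = here refl
    ∈-bools false = there (here refl)

  darts-unique : Unique (darts G)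
  darts-unique = cartesianProduct⁺ (allFin⁺ (#E G)) (((λ ()) ∷ []) ∷ ([] ∷ []))

  ∃? : {P : Dart G → Set} → Decidable P → Dec (∃ P)
  ∃? P? with any? P? (darts G)
  ... | yes some = yes (_ , proj₂ (proj₂ (find some)))
  ... | no  none = no λ (d , p) → none (lose (∈-darts d) p)

  inverse-involutive : ∀ d → inverse G (inverse G d) ≡ d
  inverse-involutive (e , b) = cong (e ,_) (not-involutive b)

  target-inverse : ∀ d → target G (inverse G d) ≡ source G d
  target-inverse d = cong (source G) (inverse-involutive d)

  inverse-injective : ∀ {d e} → inverse G d ≡ inverse G e → d ≡ e
  inverse-injective {d} {e} eq = trans (sym (inverse-involutive d)) (trans (cong (inverse G) eq) (inverse-involutive e))

  -- Reversal of walks, by which statements about predecessors become statements about successors.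
  ⟶-inverse : ∀ {d e} → d ⟶ e → inverse G e ⟶ inverse G d
  ⟶-inverse {d} {e} (eq , e≢) = trans (target-inverse e) (sym eq) ,
    λ eq′ → e≢ (trans (sym (inverse-involutive e)) (sym eq′))

  -- Reversal only swaps the two darts of each edge, which are neighbours in the list.
  ∑-inverse : ∀ (f : Dart G → ℚ) → ∑ (darts G) (λ d → f (inverse G d)) ≡ ∑ (darts G) f
  ∑-inverse f = go (allFin (#E G))
    where
    go : ∀ es → let ds = cartesianProduct es (true ∷ false ∷ []) in
         ∑ ds (λ d → f (inverse G d)) ≡ ∑ ds f
    go []       = refl
    go (e ∷ es) = trans (cong (λ s → f (e , false) + (f (e , true) + s)) (go es))
      (solve 3 (λ a b s → b :+ (a :+ s) := a :+ (b :+ s)) refl (f (e , true)) (f (e , false)) _)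

  ∑-𝟙≡ : ∀ x → ∑ (darts G) (λ d → 𝟙 (x ≟ᴰ d)) ≡ 1ℚ
  ∑-𝟙≡ x = trans (∑-cong (darts G) (λ d → sym (*-identityʳ (𝟙 (x ≟ᴰ d)))))
    (∑-pick _≟ᴰ_ (λ _ → 1ℚ) darts-unique (∈-darts x))

  Next : (Dart G → Set) → Dart G → Set
  Next S e = ∃ λ d → S d × d ⟶ e

  Next? : ∀ {S} → Decidable S → Decidable (Next S)
  Next? S? e = ∃? λ d → S? d ×-dec (d ⟶? e)

  Reach : ℕ → Dart G → Dart G → Set
  Reach zero    d = d ≡_
  Reach (suc n) d = Next (Reach n d)

  Reach? : ∀ n d → Decidable (Reach n d)
  Reach? zero    d = d ≟ᴰ_
  Reach? (suc n) d = Next? (Reach? n d)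

  size : ∀ {S} → Decidable S → ℚ
  size S? = ∑ (darts G) (λ d → 𝟙 (S? d))

  -- The nonbacktracking operator of G.
  B : (Dart G → ℚ) → Dart G → ℚ
  B h d = ∑ (darts G) (λ e → 𝟙 (d ⟶? e) * h e)

  -- The innermost factor is split off, so that inductions on the exponent pass from `h` to `B h` at
  -- a fixed dart.
  B^ : ℕ → (Dart G → ℚ) → Dart G → ℚ
  B^ zero    h = h
  B^ (suc n) h = B^ n (B h)

-- Row and column sums in a regular graph, and the growth of sets of darts.

module RegularGraph (G : Graph) (q : ℕ) (regular : Regular G (q ℕ.+ 1)) where

  open import Data.List.Membership.Propositional.Properties using (∈-allFin)
  open import Data.List.Relation.Unary.Unique.Propositional.Properties using (allFin⁺)
  open import Data.Rational
  open import Data.Rational.Properties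
  open import Data.Rational.Solver using (module +-*-Solver)
  open import Relation.Unary using (Decidable)
  open +-*-Solver
  open ℚ-Facts
  open Sums
  open DartWalks G

  κ : ℚ
  κ = ι q

  0≤κ : 0ℚ ≤ κ
  0≤κ = ι-mono {0} {q} z≤n

  out-degree : ∀ v → ∑ (darts G) (λ d → 𝟙 (source G d Fin.≟ v)) ≡ 1ℚ + κ
  out-degree v = begin
    ∑ (darts G) (λ d → 𝟙 (source G d Fin.≟ v))
      ≡⟨ ∑-cong (darts G) (λ d → sym (*-identityʳ (𝟙 (source G d Fin.≟ v)))) ⟩
    ∑ (darts G) (λ d → 𝟙 (source G d Fin.≟ v) * 1ℚ)
      ≡⟨ ∑-filter (λ d → source G d Fin.≟ v) (darts G) (λ _ → 1ℚ) ⟨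
    ∑ (filter (λ d → source G d Fin.≟ v) (darts G)) (λ _ → 1ℚ)
      ≡⟨ ∑-length (filter (λ d → source G d Fin.≟ v) (darts G)) ⟩
    ι (degree G v)
      ≡⟨ cong ι (trans (regular v) (ℕ.+-comm q 1)) ⟩
    ι (suc q)
      ≡⟨ ι-suc q ⟩
    1ℚ + κ ∎
    where open ≡-Reasoning

  -- Of the q + 1 darts leaving the target of `d`, exactly one is forbidden, namely `inverse G d`.
  row-sum : ∀ d → ∑ (darts G) (λ e → 𝟙 (d ⟶? e)) ≡ κ
  row-sum d = begin
    rows                                 ≡⟨ solve 2 (λ r i → r := (i :+ r) :- i) refl rows 1ℚ ⟩
    (1ℚ + rows) - 1ℚ                     ≡⟨ cong (λ z → (z + rows) - 1ℚ) (∑-𝟙≡ (inverse G d)) ⟨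
    (∑ (darts G) (λ e → 𝟙 (inverse G d ≟ᴰ e)) + rows) - 1ℚ
      ≡⟨ cong (_- 1ℚ) (∑-distrib-+ (darts G) _ _) ⟨
    ∑ (darts G) (λ e → 𝟙 (inverse G d ≟ᴰ e) + 𝟙 (d ⟶? e)) - 1ℚ
      ≡⟨ cong (_- 1ℚ) (∑-cong (darts G) split) ⟩
    ∑ (darts G) (λ e → 𝟙 (source G e Fin.≟ target G d)) - 1ℚ
      ≡⟨ cong (_- 1ℚ) (out-degree (target G d)) ⟩
    (1ℚ + κ) - 1ℚ                        ≡⟨ solve 2 (λ i k → (i :+ k) :- i := k) refl 1ℚ κ ⟩
    κ                                    ∎
    where
    open ≡-Reasoning
    rows = ∑ (darts G) (λ e → 𝟙 (d ⟶? e))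
    split : ∀ e → 𝟙 (inverse G d ≟ᴰ e) + 𝟙 (d ⟶? e) ≡ 𝟙 (source G e Fin.≟ target G d)
    split e with inverse G d ≟ᴰ e
    ... | yes refl = trans (cong (1ℚ +_) (𝟙-no (d ⟶? inverse G d) (λ (_ , ≢) → ≢ refl)))
          (sym (𝟙-yes (source G (inverse G d) Fin.≟ target G d) refl))
    ... | no ≢e = trans (+-identityˡ (𝟙 (d ⟶? e))) (𝟙-⇔ (d ⟶? e) (source G e Fin.≟ target G d)
          (λ (eq , _) → sym eq) (λ eq → sym eq , λ e≡ → ≢e (sym e≡)))

  -- Reversal carries the predecessors of `e` to the successors of `inverse G e`.
  column-sum : ∀ e → ∑ (darts G) (λ d → 𝟙 (d ⟶? e)) ≡ κ
  column-sum e = begin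
    ∑ (darts G) (λ d → 𝟙 (d ⟶? e))
      ≡⟨ ∑-cong (darts G) (λ d → 𝟙-⇔ (d ⟶? e) (inverse G e ⟶? inverse G d) ⟶-inverse
           (λ w → subst₂ _⟶_ (inverse-involutive d) (inverse-involutive e) (⟶-inverse w))) ⟩
    ∑ (darts G) (λ d → 𝟙 (inverse G e ⟶? inverse G d))
      ≡⟨ ∑-inverse (λ d → 𝟙 (inverse G e ⟶? d)) ⟩
    ∑ (darts G) (λ d → 𝟙 (inverse G e ⟶? d))
      ≡⟨ row-sum (inverse G e) ⟩
    κ ∎
    where open ≡-Reasoning

  -- Grouping the darts by their source meets every vertex q + 1 times. Thus sum zero on vertices
  -- becomes sum zero on darts.
  ∑-source : ∀ (f : V G → ℚ) → ∑ (darts G) (λ d → f (source G d)) ≡ (1ℚ + κ) * ∑ (allFin (#V G)) f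
  ∑-source f = begin
    ∑ (darts G) (λ d → f (source G d))
      ≡⟨ ∑-cong (darts G) (λ d → ∑-pick Fin._≟_ f (allFin⁺ (#V G)) (∈-allFin (source G d))) ⟨
    ∑ (darts G) (λ d → ∑ (allFin (#V G)) (λ v → 𝟙 (source G d Fin.≟ v) * f v))
      ≡⟨ ∑-swap (darts G) (allFin (#V G)) _ ⟩
    ∑ (allFin (#V G)) (λ v → ∑ (darts G) (λ d → 𝟙 (source G d Fin.≟ v) * f v))
      ≡⟨ ∑-cong (allFin (#V G)) (λ v → trans (∑-*ʳ (darts G) (f v) _) (cong (_* f v) (out-degree v))) ⟩
    ∑ (allFin (#V G)) (λ v → (1ℚ + κ) * f v)
      ≡⟨ ∑-*ˡ (allFin (#V G)) (1ℚ + κ) f ⟩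
    (1ℚ + κ) * ∑ (allFin (#V G)) f ∎
    where open ≡-Reasoning

  ∑-target : ∀ (f : V G → ℚ) → ∑ (darts G) (λ d → f (target G d)) ≡ (1ℚ + κ) * ∑ (allFin (#V G)) f
  ∑-target f = trans (∑-inverse (λ d → f (source G d))) (∑-source f)

  module _ {S : Dart G → Set} (S? : Decidable S) where

    private
      -- The number of predecessors of `e` in `S`; its total over all `e` counts the steps that
      -- start in `S`.
      inflow : Dart G → ℚ
      inflow e = ∑ (darts G) (λ d → 𝟙 (S? d) * 𝟙 (d ⟶? e))

      ∑-inflow : ∑ (darts G) inflow ≡ κ * size S?
      ∑-inflow = begin
        ∑ (darts G) inflow
          ≡⟨ ∑-swap (darts G) (darts G) _ ⟨
        ∑ (darts G) (λ d → ∑ (darts G) (λ e → 𝟙 (S? d) * 𝟙 (d ⟶? e)))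
          ≡⟨ ∑-cong (darts G) (λ d → trans (∑-*ˡ (darts G) (𝟙 (S? d)) _)
               (trans (cong (𝟙 (S? d) *_) (row-sum d)) (*-comm (𝟙 (S? d)) κ))) ⟩
        ∑ (darts G) (λ d → κ * 𝟙 (S? d))
          ≡⟨ ∑-*ˡ (darts G) κ _ ⟩
        κ * size S? ∎
        where open ≡-Reasoning

      𝟙*𝟙≤𝟙 : ∀ d e → 𝟙 (S? d) * 𝟙 (d ⟶? e) ≤ 𝟙 (d ⟶? e)
      𝟙*𝟙≤𝟙 d e = ≤-trans (*-mono-≤ 0≤1 (0≤𝟙 (d ⟶? e)) (𝟙≤1 (S? d)) ≤-refl)
        (≤-reflexive (*-identityˡ (𝟙 (d ⟶? e))))

      -- A dart has κ predecessors in all, and none of them is in `S` unless the dart belongs to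
      -- `Next S`.
      inflow≤ : ∀ e → inflow e ≤ κ * 𝟙 (Next? S? e)
      inflow≤ e with Next? S? e
      ... | yes _ = begin
        inflow e                          ≤⟨ ∑-mono (darts G) (λ d → 𝟙*𝟙≤𝟙 d e) ⟩
        ∑ (darts G) (λ d → 𝟙 (d ⟶? e))    ≡⟨ column-sum e ⟩
        κ                                 ≡⟨ *-identityʳ κ ⟨
        κ * 1ℚ                            ∎
        where open ≤-Reasoning
      ... | no ¬next = ≤-reflexive (trans (trans (∑-cong (darts G) none) (∑-zero (darts G))) (sym (*-zeroʳ κ)))
        where
        none : ∀ d → 𝟙 (S? d) * 𝟙 (d ⟶? e) ≡ 0ℚ
        none d with S? d
        ... | no  _  = *-zeroˡ (𝟙 (d ⟶? e))
        ... | yes s  = trans (*-identityˡ (𝟙 (d ⟶? e))) (𝟙-no (d ⟶? e) (λ w → ¬next (d , s , w)))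

    -- Double counting of the steps out of `S`: κ of them leave each dart of `S`, and at most κ
    -- enter each dart of `Next S`. The factor κ is kept on both sides, which avoids a division and
    -- makes the gain in `size-grows` a whole unit.
    size-mono : κ * size S? ≤ κ * size (Next? S?)
    size-mono = begin
      κ * size S?                                ≡⟨ ∑-inflow ⟨
      ∑ (darts G) inflow                         ≤⟨ ∑-mono (darts G) inflow≤ ⟩
      ∑ (darts G) (λ e → κ * 𝟙 (Next? S? e))     ≡⟨ ∑-*ˡ (darts G) κ _ ⟩
      κ * size (Next? S?)                        ∎
      where open ≤-Reasoning

    -- The predecessor `d′` is missing from `S`, so the inflow at `e` falls short of κ by at least
    -- one.
    size-grows : ∀ {d d′ e} → S d → d ⟶ e → d′ ⟶ e → ¬ S d′ → κ * size S? + 1ℚ ≤ κ * size (Next? S?)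
    size-grows {d} {d′} {e} s d⟶e d′⟶e ¬s = begin
      κ * size S? + 1ℚ                           ≡⟨ cong (_+ 1ℚ) ∑-inflow ⟨
      ∑ (darts G) inflow + 1ℚ                    ≤⟨ ∑-gain (∈-darts e) inflow≤ gain ⟩
      ∑ (darts G) (λ e → κ * 𝟙 (Next? S? e))     ≡⟨ ∑-*ˡ (darts G) κ _ ⟩
      κ * size (Next? S?)                        ∎
      where
      open ≤-Reasoning
      gain : inflow e + 1ℚ ≤ κ * 𝟙 (Next? S? e)
      gain = begin
        inflow e + 1ℚ                            ≤⟨ ∑-gain (∈-darts d′) (λ d → 𝟙*𝟙≤𝟙 d e) (≤-reflexive
                                                      (trans (cong₂ (λ a b → a * b + 1ℚ)
                                                               (𝟙-no (S? d′) ¬s) (𝟙-yes (d′ ⟶? e) d′⟶e))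
                                                             (sym (𝟙-yes (d′ ⟶? e) d′⟶e)))) ⟩
        ∑ (darts G) (λ d → 𝟙 (d ⟶? e))           ≡⟨ column-sum e ⟩
        κ                                        ≡⟨ *-identityʳ κ ⟨
        κ * 1ℚ                                   ≡⟨ cong (κ *_) (𝟙-yes (Next? S? e) (d , s , d⟶e)) ⟨
        κ * 𝟙 (Next? S? e)                       ∎

-- Primitivity of the nonbacktracking operator.

module Mixing (G : Graph) (connected : Connected G) (¬bipartite : ¬ Bipartite G)
  (q : ℕ) (3≤q+1 : 3 ℕ.≤ q ℕ.+ 1) (regular : Regular G (q ℕ.+ 1)) where
  open import Data.Rational
  open import Data.Rational.Properties
  open import Relation.Binary.Construct.Closure.ReflexiveTransitive using (Star; ε; _◅_)
  open import Relation.Nullary.Decidable using (from-yes; decidable-stable)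
  open import Relation.Unary using (Decidable)
  open ℚ-Facts
  open Sums
  open DartWalks G
  open RegularGraph G q regular

  -- Pigeonhole: otherwise `x` and `y` would cover all darts at `v`, whose number is at least three.
  -- When only one dart must be avoided, it is passed twice.
  third-dart : ∀ v x y → ∃ λ e → source G e ≡ v × x ≢ e × y ≢ e
  third-dart v x y with ∃? (λ e → (source G e Fin.≟ v) ×-dec ¬? (x ≟ᴰ e) ×-dec ¬? (y ≟ᴰ e))
  ... | yes e   = e
  ... | no none = contradiction (<-≤-trans (from-yes (ι 2 <? ι 3)) 3≤2) (<-irrefl refl)
    where
    covered : ∀ e → 𝟙 (source G e Fin.≟ v) ≤ 𝟙 (x ≟ᴰ e) + 𝟙 (y ≟ᴰ e)
    covered e with x ≟ᴰ e
    ... | yes _ = ≤-trans (𝟙≤1 (source G e Fin.≟ v))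
            (subst (_≤ 1ℚ + 𝟙 (y ≟ᴰ e)) (+-identityʳ 1ℚ) (+-monoʳ-≤ 1ℚ (0≤𝟙 (y ≟ᴰ e))))
    ... | no x≢ with y ≟ᴰ e
    ...   | yes _ = 𝟙≤1 (source G e Fin.≟ v)
    ...   | no y≢ = ≤-reflexive (𝟙-no (source G e Fin.≟ v) (λ eq → none (e , eq , x≢ , y≢)))
    3≤2 : ι 3 ≤ ι 2
    3≤2 = begin
      ι 3                                                     ≤⟨ ι-mono 3≤q+1 ⟩
      ι (q ℕ.+ 1)                                             ≡⟨ cong ι (ℕ.+-comm q 1) ⟩
      ι (suc q)                                               ≡⟨ ι-suc q ⟩
      1ℚ + κ                                                  ≡⟨ out-degree v ⟨
      ∑ (darts G) (λ e → 𝟙 (source G e Fin.≟ v))              ≤⟨ ∑-mono (darts G) covered ⟩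
      ∑ (darts G) (λ e → 𝟙 (x ≟ᴰ e) + 𝟙 (y ≟ᴰ e))            ≡⟨ ∑-distrib-+ (darts G) _ _ ⟩
      ∑ (darts G) (λ e → 𝟙 (x ≟ᴰ e)) + ∑ (darts G) (λ e → 𝟙 (y ≟ᴰ e))
                                                              ≡⟨ cong₂ _+_ (∑-𝟙≡ x) (∑-𝟙≡ y) ⟩
      ι 2                                                     ∎
      where open ≤-Reasoning

  predecessor : ∀ e → ∃ λ d → d ⟶ e
  predecessor e with third-dart (source G e) e e
  ... | x , eq , e≢x , _ = inverse G x , trans (target-inverse x) eq ,
    λ e≡ → e≢x (trans e≡ (inverse-involutive x))

  -- A violation of this closure consists of exactly the data that `size-grows` takes, so it
  -- describes the case without guaranteed growth.
  SiblingClosed : (Dart G → Set) → Set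
  SiblingClosed S = ∀ {d d′ e} → S d → d ⟶ e → d′ ⟶ e → S d′

  siblingClosed? : ∀ {S} → Decidable S →
    SiblingClosed S ⊎ (∃ λ d → ∃ λ d′ → ∃ λ e → S d × d ⟶ e × d′ ⟶ e × ¬ S d′)
  siblingClosed? S? with ∃? (λ d → ∃? λ d′ → ∃? λ e → S? d ×-dec (d ⟶? e) ×-dec (d′ ⟶? e) ×-dec ¬? (S? d′))
  ... | yes violation = inj₂ violation
  ... | no  closed    = inj₁ λ {d} {d′} {e} s w w′ →
          decidable-stable (S? d′) λ ¬s → closed (d , d′ , e , s , w , w′ , ¬s)

  module _ {S : Dart G → Set} (S? : Decidable S) (closed : SiblingClosed S)
           (closed′ : SiblingClosed (Next S)) where

    private
      -- Two darts into one vertex have a common continuation, because some third dart there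
      -- reverses neither. A sibling-closed set therefore depends on targets only.
      same-target : ∀ {S} → SiblingClosed S → ∀ {d d′} → target G d ≡ target G d′ → S d → S d′
      same-target closed {d} {d′} eq s with third-dart (target G d) (inverse G d) (inverse G d′)
      ... | e , src , ≢e , ≢e′ = closed s (sym src , λ eq → ≢e (sym eq)) (trans (sym eq) (sym src) , λ eq → ≢e′ (sym eq))

      T T′ : V G → Set
      T  v = ∃ λ d → S d × target G d ≡ v
      T′ v = ∃ λ d → Next S d × target G d ≡ v

      T? : Decidable T
      T? v = ∃? λ d → S? d ×-dec (target G d Fin.≟ v)

      -- If `x` happens to reverse the given dart of `S`, that dart is exchanged for another one
      -- into the same vertex, which is in `S` by `same-target`.
      out : ∀ x → T (source G x) → Next S x
      out x (d , s , eq) with x ≟ᴰ inverse G d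
      ... | no x≢ = d , s , eq , x≢
      ... | yes refl with third-dart (target G d) (inverse G d) (inverse G d)
      ...   | y , src , ≢y , _ = inverse G y ,
              same-target closed (sym (trans (target-inverse y) src)) s ,
              trans (target-inverse y) src , λ eq → ≢y (trans eq (inverse-involutive y))

      T⇒T′ : ∀ {u v} → Adjacent G u v → T u → T′ v
      T⇒T′ (x , refl , refl) t = x , out x t , refl

      -- The reverse of the edge dart `x` arrives at `u`, hence lies in `Next S`; its predecessor in
      -- `S` ends where that reverse starts, at `v`.
      T′⇒T : ∀ {u v} → Adjacent G u v → T′ u → T v
      T′⇒T (x , refl , refl) (d , s , eq) with same-target closed′ {d} {inverse G x} (trans eq (sym (target-inverse x))) s
      ... | c , sc , w , _ = c , sc , w

      -- Crossing an edge exchanges `T` and `T′`. So membership in their union spreads along walks,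
      -- and so does membership in their intersection.
      T∪T′ : ∀ {u v} → Star (Adjacent G) u v → T u ⊎ T′ u → T v ⊎ T′ v
      T∪T′ ε        t        = t
      T∪T′ (a ◅ as) (inj₁ t) = T∪T′ as (inj₂ (T⇒T′ a t))
      T∪T′ (a ◅ as) (inj₂ t) = T∪T′ as (inj₁ (T′⇒T a t))

      T∩T′ : ∀ {u v} → Star (Adjacent G) u v → T u → T′ u → T v
      T∩T′ ε        t t′ = t
      T∩T′ (a ◅ as) t t′ = T∩T′ as (T′⇒T a t′) (T⇒T′ a t)

    -- T and T′ cover V and every edge joins one to the other; if they were disjoint, membership in T
    -- would be a 2-colouring.
    closed⇒full : ∃ S → ∀ d → S d
    closed⇒full (s₀ , s) x with ∃? (λ d → does (T? (source G d)) Bool.≟ does (T? (target G d)))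
    ... | no none = contradiction (colour , λ e eq → none ((e , true) , eq)) ¬bipartite
      where
      colour : V G → Bool
      colour v = does (T? v)
    ... | yes (d , same) with T? (source G d) | T? (target G d)
    -- Both ends of `d` are in `T`. The source is then also in `T′`, being adjacent to the target,
    -- and from a vertex in both sets `T` spreads everywhere.
    ...   | yes t | yes t″ = covers (T∩T′ (connected (source G d) (target G x)) t (T⇒T′ (inverse G d , refl , target-inverse d) t″))
      where
      covers : T (target G x) → S x
      covers (c , sc , eq) = same-target closed eq sc
    -- Neither end is in `T`. By connectedness the target of `d` is in `T′`, and crossing the edge
    -- puts the source in `T`.
    ...   | no ¬t | no ¬t″ with T∪T′ (connected (target G s₀) (target G d)) (inj₁ (s₀ , s , refl))
    ...     | inj₁ t″ = contradiction t″ ¬t″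
    ...     | inj₂ t′ = contradiction (T′⇒T (inverse G d , refl , target-inverse d) t′) ¬t

  reach-nonempty : ∀ n d → ∃ (Reach n d)
  reach-nonempty zero    d = d , refl
  reach-nonempty (suc n) d with reach-nonempty n d
  ... | c , r with third-dart (target G c) (inverse G c) (inverse G c)
  ...   | e , src , ≢e , _ = e , c , r , sym src , λ eq → ≢e (sym eq)

  -- Progress is measured over two steps, since fullness needs the closure of both the reached set
  -- and its set of successors.
  reach-or-grow : ∀ d m → (∀ e → Reach (m ℕ.* 2) d e) ⊎ ι m ≤ κ * size (Reach? (m ℕ.* 2) d)
  reach-or-grow d zero = inj₂ (*-nonNeg 0≤κ (∑-nonNeg (darts G) (λ e → 0≤𝟙 (d ≟ᴰ e))))
  reach-or-grow d (suc m) with reach-or-grow d m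
  -- Fullness persists because every dart has a predecessor, here used twice.
  ... | inj₁ full = inj₁ λ e → let c , w = predecessor e ; b , w′ = predecessor c in c , (b , full b , w′) , w
  ... | inj₂ large with siblingClosed? (Reach? (m ℕ.* 2) d) | siblingClosed? (Reach? (suc (m ℕ.* 2)) d)
  ...   | inj₁ closed | inj₁ closed′ = inj₁ λ e → let c , w = predecessor e ; b , w′ = predecessor c in
            c , (b , closed⇒full (Reach? (m ℕ.* 2) d) closed closed′ (reach-nonempty (m ℕ.* 2) d) b , w′) , w
  ...   | inj₂ (_ , _ , _ , s , w , w′ , ¬s) | _ = inj₂ (begin
            ι (suc m)                                     ≡⟨ ι-suc m ⟩
            1ℚ + ι m                                      ≤⟨ +-monoʳ-≤ 1ℚ large ⟩
            1ℚ + κ * size (Reach? (m ℕ.* 2) d)            ≡⟨ +-comm 1ℚ (κ * size (Reach? (m ℕ.* 2) d)) ⟩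
            κ * size (Reach? (m ℕ.* 2) d) + 1ℚ            ≤⟨ size-grows (Reach? (m ℕ.* 2) d) s w w′ ¬s ⟩
            κ * size (Reach? (suc (m ℕ.* 2)) d)           ≤⟨ size-mono (Reach? (suc (m ℕ.* 2)) d) ⟩
            κ * size (Reach? (suc m ℕ.* 2) d)             ∎)
          where open ≤-Reasoning
  ...   | inj₁ _ | inj₂ (_ , _ , _ , s , w , w′ , ¬s) = inj₂ (begin
            ι (suc m)                                     ≡⟨ ι-suc m ⟩
            1ℚ + ι m                                      ≤⟨ +-monoʳ-≤ 1ℚ large ⟩
            1ℚ + κ * size (Reach? (m ℕ.* 2) d)            ≤⟨ +-monoʳ-≤ 1ℚ (size-mono (Reach? (m ℕ.* 2) d)) ⟩
            1ℚ + κ * size (Reach? (suc (m ℕ.* 2)) d)      ≡⟨ +-comm 1ℚ (κ * size (Reach? (suc (m ℕ.* 2)) d)) ⟩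
            κ * size (Reach? (suc (m ℕ.* 2)) d) + 1ℚ      ≤⟨ size-grows (Reach? (suc (m ℕ.* 2)) d) s w w′ ¬s ⟩
            κ * size (Reach? (suc m ℕ.* 2) d)             ∎)
          where open ≤-Reasoning

  -- Growth must stop: `m` is chosen larger than κ times the number of darts, which bounds every
  -- `κ * size`. The same number of steps serves all pairs of darts.
  mixing : ∃ λ k → ∀ d e → Reach (suc k) d e
  mixing with archimedean (κ * ∑ (darts G) (λ _ → 1ℚ))
  ... | m , bound = suc (m ℕ.* 2) , full
    where
    full : ∀ d → ∀ e → Reach (suc m ℕ.* 2) d e
    full d with reach-or-grow d (suc m)
    ... | inj₁ reach = reach
    ... | inj₂ large = contradiction (begin-strict
            ι m                                         ≤⟨ ι-mono (ℕ.n≤1+n m) ⟩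
            ι (suc m)                                   ≤⟨ large ⟩
            κ * size (Reach? (suc m ℕ.* 2) d)           ≤⟨ *-mono-≤ 0≤κ (∑-nonNeg (darts G) (λ e → 0≤𝟙 (Reach? (suc m ℕ.* 2) d e))) ≤-refl
                                                             (∑-mono (darts G) (λ e → 𝟙≤1 (Reach? (suc m ℕ.* 2) d e))) ⟩
            κ * ∑ (darts G) (λ _ → 1ℚ)                  <⟨ bound ⟩
            ι m                                         ∎) (<-irrefl refl)
          where open ≤-Reasoning

-- Powers of rationals and the choice of a contraction rate.

module Powers where

  open import Algebra.Bundles using (CommutativeRing)
  open import Data.Rational
  open import Data.Rational.Properties
  open import Data.Rational.Solver using (module +-*-Solver)
  open import Relation.Nullary.Decidable using (from-yes)
  open import Algebra.Properties.CommutativeSemiring.Exp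
    (CommutativeRing.commutativeSemiring +-*-commutativeRing) public
    using (_^_; ^-homo-*; ^-distrib-*)
  open +-*-Solver
  open ℚ-Facts
  open Sums

  -- A rational number whose square 9/16 exceeds 1/2. Rates of at least this size satisfy the lower
  -- bound `q ^ -1/2` for every q at least 2.
  ¾ : ℚ
  ¾ = ℤ.+ 3 / 4

  ^-nonNeg : ∀ {p} → 0ℚ ≤ p → ∀ n → 0ℚ ≤ p ^ n
  ^-nonNeg 0≤p zero    = 0≤1
  ^-nonNeg 0≤p (suc n) = *-nonNeg 0≤p (^-nonNeg 0≤p n)

  ^-pos : ∀ {p} → 0ℚ < p → ∀ n → 0ℚ < p ^ n
  ^-pos 0<p zero    = positive⁻¹ 1ℚ
  ^-pos 0<p (suc n) = *-pos 0<p (^-pos 0<p n)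

  ^-≤1 : ∀ {p} → 0ℚ ≤ p → p ≤ 1ℚ → ∀ n → p ^ n ≤ 1ℚ
  ^-≤1 0≤p p≤1 zero    = ≤-refl
  ^-≤1 {p} 0≤p p≤1 (suc n) = *-mono-≤ {p} {1ℚ} 0≤1 (^-nonNeg 0≤p n) p≤1 (^-≤1 0≤p p≤1 n)

  1≤^ : ∀ {p} → 1ℚ ≤ p → ∀ n → 1ℚ ≤ p ^ n
  1≤^ 1≤p zero    = ≤-refl
  1≤^ {p} 1≤p (suc n) = *-mono-≤ {1ℚ} {p} (≤-trans 0≤1 1≤p) 0≤1 1≤p (1≤^ 1≤p n)

  ^-antitone : ∀ {p} → 0ℚ ≤ p → p ≤ 1ℚ → ∀ {m n} → m ℕ.≤ n → p ^ n ≤ p ^ m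
  ^-antitone {p} 0≤p p≤1 {m} {n} m≤n = begin
    p ^ n                       ≡⟨ cong (p ^_) (ℕ.m+[n∸m]≡n m≤n) ⟨
    p ^ (m ℕ.+ (n ℕ.∸ m))       ≡⟨ ^-homo-* p m (n ℕ.∸ m) ⟩
    p ^ m * p ^ (n ℕ.∸ m)       ≤⟨ *-monoˡ-≤-nonNeg (p ^ m) {{nonNegative (^-nonNeg 0≤p m)}} (^-≤1 0≤p p≤1 (n ℕ.∸ m)) ⟩
    p ^ m * 1ℚ                  ≡⟨ *-identityʳ (p ^ m) ⟩
    p ^ m                       ∎
    where open ≤-Reasoning

  -- The induction step discards the nonnegative term `n x²`.
  bernoulli : ∀ {x} → 0ℚ ≤ x → x ≤ 1ℚ → ∀ n → 1ℚ - ι n * x ≤ (1ℚ - x) ^ n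
  bernoulli {x} 0≤x x≤1 zero    = ≤-reflexive (trans (cong (λ z → 1ℚ - z) (*-zeroˡ x)) (+-identityʳ 1ℚ))
  bernoulli {x} 0≤x x≤1 (suc n) = begin
    1ℚ - ι (suc n) * x                       ≡⟨ cong (λ k → 1ℚ - k * x) (ι-suc n) ⟩
    1ℚ - (1ℚ + ι n) * x                      ≡⟨ +-identityʳ (1ℚ - (1ℚ + ι n) * x) ⟨
    1ℚ - (1ℚ + ι n) * x + 0ℚ                 ≤⟨ +-monoʳ-≤ (1ℚ - (1ℚ + ι n) * x)
                                                  (*-nonNeg (ι-mono {0} {n} ℕ.z≤n) (*-nonNeg 0≤x 0≤x)) ⟩
    1ℚ - (1ℚ + ι n) * x + ι n * (x * x)      ≡⟨ solve 2 (λ k x → con 1ℚ :- (con 1ℚ :+ k) :* x :+ k :* (x :* x)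
                                                          := (con 1ℚ :- x) :* (con 1ℚ :- k :* x)) refl (ι n) x ⟩
    (1ℚ - x) * (1ℚ - ι n * x)                ≤⟨ *-monoˡ-≤-nonNeg (1ℚ - x) {{nonNegative (p≤q⇒0≤q-p x≤1)}} (bernoulli 0≤x x≤1 n) ⟩
    (1ℚ - x) ^ suc n                         ∎
    where open ≤-Reasoning

  -- For β = 1 - x with n x κ ^ n ≤ 1, Bernoulli gives κ ^ n * β ^ n ≥ κ ^ n - n x κ ^ n ≥ κ ^ n - 1.
  contraction-rate : ∀ {κ} → 1ℚ ≤ κ → ∀ k → ∃ λ β → ¾ ≤ β × β < 1ℚ × κ ^ suc k - 1ℚ ≤ κ ^ suc k * β ^ suc k
  -- For n = `suc k` the number `x` is the inverse of 4 n κ ^ n. The factor 4 gives x at most 1/4,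
  -- hence a rate of at least `¾`; the other factors give n x κ ^ n at most 1.
  contraction-rate {κ} 1≤κ k = from-divisor (divide {ι 4 * (ι (suc k) * κ ^ suc k)} {1ℚ}
    (*-pos (from-yes (0ℚ <? ι 4)) (*-pos (<-≤-trans (positive⁻¹ 1ℚ) (ι-mono {1} {suc k} (ℕ.s≤s ℕ.z≤n)))
      (^-pos (<-≤-trans (positive⁻¹ 1ℚ) 1≤κ) (suc k))))
    (positive⁻¹ 1ℚ))
    where
    from-divisor : (∃ λ x → 0ℚ < x × ι 4 * (ι (suc k) * κ ^ suc k) * x ≡ 1ℚ) →
      ∃ λ β → ¾ ≤ β × β < 1ℚ × κ ^ suc k - 1ℚ ≤ κ ^ suc k * β ^ suc k
    from-divisor (x , 0<x , 4px≡1) = 1ℚ - x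
        , 0≤q-p⇒p≤q (subst (0ℚ ≤_) (solve 1 (λ x → con (½ * ½) :* (con 1ℚ :- con (ι 4) :* x)
                                                 := con 1ℚ :- x :- con ¾) refl x)
            (*-nonNeg {½ * ½} (from-yes (0ℚ ≤? ½ * ½)) (p≤q⇒0≤q-p 4x≤1)))
        , subst (1ℚ - x <_) (+-identityʳ 1ℚ) (+-monoʳ-< 1ℚ (neg-antimono-< 0<x))
        , (begin
            K - 1ℚ                              ≤⟨ +-monoʳ-≤ K (neg-antimono-≤ px≤1) ⟩
            K - ι (suc k) * K * x               ≡⟨ solve 3 (λ K i x → K :- i :* K :* x := K :* (con 1ℚ :- i :* x)) refl K (ι (suc k)) x ⟩
            K * (1ℚ - ι (suc k) * x)            ≤⟨ *-monoˡ-≤-nonNeg K {{nonNegative 0≤K}} (bernoulli (<⇒≤ 0<x) x≤1 (suc k)) ⟩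
            K * (1ℚ - x) ^ suc k                ∎)
      where
      open ≤-Reasoning
      K = κ ^ suc k
      0≤K : 0ℚ ≤ K
      0≤K = ^-nonNeg (≤-trans 0≤1 1≤κ) (suc k)
      0≤x = <⇒≤ 0<x
      1≤p : 1ℚ ≤ ι (suc k) * K
      1≤p = *-mono-≤ {1ℚ} {ι (suc k)} (ι-mono {0} {suc k} ℕ.z≤n) 0≤1 (ι-mono {1} {suc k} (ℕ.s≤s ℕ.z≤n)) (1≤^ 1≤κ (suc k))
      4x≤1 : ι 4 * x ≤ 1ℚ
      4x≤1 = begin
        ι 4 * x                            ≡⟨ cong (_* x) (*-identityʳ (ι 4)) ⟨
        ι 4 * 1ℚ * x                       ≤⟨ *-monoʳ-≤-nonNeg x {{nonNegative 0≤x}} (*-monoˡ-≤-nonNeg (ι 4) {{nonNegative (from-yes (0ℚ ≤? ι 4))}} 1≤p) ⟩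
        ι 4 * (ι (suc k) * K) * x          ≡⟨ 4px≡1 ⟩
        1ℚ                                 ∎
      px≤1 : ι (suc k) * K * x ≤ 1ℚ
      px≤1 = begin
        ι (suc k) * K * x                  ≡⟨ cong (_* x) (*-identityˡ (ι (suc k) * K)) ⟨
        1ℚ * (ι (suc k) * K) * x           ≤⟨ *-monoʳ-≤-nonNeg x {{nonNegative 0≤x}}
                                                (*-monoʳ-≤-nonNeg (ι (suc k) * K) {{nonNegative (≤-trans 0≤1 1≤p)}} (from-yes (1ℚ ≤? ι 4))) ⟩
        ι 4 * (ι (suc k) * K) * x          ≡⟨ 4px≡1 ⟩
        1ℚ                                 ∎
      x≤1 : x ≤ 1ℚ
      x≤1 = begin
        x                                  ≡⟨ *-identityˡ x ⟨
        1ℚ * x                             ≤⟨ *-monoʳ-≤-nonNeg x {{nonNegative 0≤x}} (from-yes (1ℚ ≤? ι 4)) ⟩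
        ι 4 * x                            ≤⟨ 4x≤1 ⟩
        1ℚ                                 ∎

-- Exponential decay of the powers of the operator on functions of sum zero.

module Contraction (G : Graph) (connected : Connected G) (¬bipartite : ¬ Bipartite G)
  (q : ℕ) (3≤q+1 : 3 ℕ.≤ q ℕ.+ 1) (regular : Regular G (q ℕ.+ 1)) where

  open import Data.Nat.Induction using (<-rec)
  open import Data.Rational
  open import Data.Rational.Properties
  open import Data.Rational.Solver using (module +-*-Solver)
  open import Relation.Nullary.Decidable using (from-yes)
  open +-*-Solver
  open ℚ-Facts
  open Sums
  open Powers
  open DartWalks G
  open RegularGraph G q regular
  open Mixing G connected ¬bipartite q 3≤q+1 regular

  B-cong : ∀ {h h′ : Dart G → ℚ} → (∀ d → h d ≡ h′ d) → ∀ d → B h d ≡ B h′ d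
  B-cong eq d = ∑-cong (darts G) (λ e → cong (𝟙 (d ⟶? e) *_) (eq e))

  B^-cong : ∀ n {h h′ : Dart G → ℚ} → (∀ d → h d ≡ h′ d) → ∀ d → B^ n h d ≡ B^ n h′ d
  B^-cong zero    eq = eq
  B^-cong (suc n) eq = B^-cong n (B-cong eq)

  B-const : ∀ c d → B (λ _ → c) d ≡ κ * c
  B-const c d = trans (∑-*ʳ (darts G) c _) (cong (_* c) (row-sum d))

  B^-const : ∀ n c d → B^ n (λ _ → c) d ≡ κ ^ n * c
  B^-const zero    c d = sym (*-identityˡ c)
  B^-const (suc n) c d = trans (B^-cong n (B-const c) d) (trans (B^-const n (κ * c) d)
    (solve 3 (λ p k c → p :* (k :* c) := (k :* p) :* c) refl (κ ^ n) κ c))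

  B-distrib-- : ∀ (h h′ : Dart G → ℚ) d → B (λ e → h e - h′ e) d ≡ B h d - B h′ d
  B-distrib-- h h′ d = trans
    (∑-cong (darts G) (λ e → solve 3 (λ i a b → i :* (a :- b) := i :* a :- i :* b) refl (𝟙 (d ⟶? e)) (h e) (h′ e)))
    (∑-distrib-- (darts G) _ _)

  B^-distrib-- : ∀ n (h h′ : Dart G → ℚ) d → B^ n (λ e → h e - h′ e) d ≡ B^ n h d - B^ n h′ d
  B^-distrib-- zero    h h′ d = refl
  B^-distrib-- (suc n) h h′ d = trans (B^-cong n (B-distrib-- h h′) d) (B^-distrib-- n (B h) (B h′) d)

  B^-+ : ∀ m n (h : Dart G → ℚ) d → B^ (m ℕ.+ n) h d ≡ B^ n (B^ m h) d
  B^-+ zero    n h d = refl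
  B^-+ (suc m) n h d = B^-+ m n (B h) d

  ∑-B : ∀ h → ∑ (darts G) (B h) ≡ κ * ∑ (darts G) h
  ∑-B h = begin
    ∑ (darts G) (B h)
      ≡⟨ ∑-swap (darts G) (darts G) _ ⟩
    ∑ (darts G) (λ e → ∑ (darts G) (λ d → 𝟙 (d ⟶? e) * h e))
      ≡⟨ ∑-cong (darts G) (λ e → trans (∑-*ʳ (darts G) (h e) _) (cong (_* h e) (column-sum e))) ⟩
    ∑ (darts G) (λ e → κ * h e)
      ≡⟨ ∑-*ˡ (darts G) κ h ⟩
    κ * ∑ (darts G) h ∎
    where open ≡-Reasoning

  ∑-B^≡0 : ∀ n {h} → ∑ (darts G) h ≡ 0ℚ → ∑ (darts G) (B^ n h) ≡ 0ℚ
  ∑-B^≡0 zero    ∑h≡0 = ∑h≡0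
  ∑-B^≡0 (suc n) {h} ∑h≡0 = ∑-B^≡0 n (trans (∑-B h) (trans (cong (κ *_) ∑h≡0) (*-zeroʳ κ)))

  -- `B^ n h d` sums `h` over the ends of walks with multiplicity, and each reached dart ends at
  -- least one walk.
  ∑-reach≤B^ : ∀ n {h : Dart G → ℚ} → (∀ e → 0ℚ ≤ h e) → ∀ d →
               ∑ (darts G) (λ e → 𝟙 (Reach? n d e) * h e) ≤ B^ n h d
  ∑-reach≤B^ zero {h} 0≤h d = ≤-reflexive (∑-pick _≟ᴰ_ h darts-unique (∈-darts d))
  ∑-reach≤B^ (suc n) {h} 0≤h d = begin
    ∑ (darts G) (λ e → 𝟙 (Reach? (suc n) d e) * h e)
      ≤⟨ ∑-mono (darts G) through ⟩
    ∑ (darts G) (λ e → ∑ (darts G) (λ c → 𝟙 (Reach? n d c) * (𝟙 (c ⟶? e) * h e)))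
      ≡⟨ ∑-swap (darts G) (darts G) _ ⟨
    ∑ (darts G) (λ c → ∑ (darts G) (λ e → 𝟙 (Reach? n d c) * (𝟙 (c ⟶? e) * h e)))
      ≡⟨ ∑-cong (darts G) (λ c → ∑-*ˡ (darts G) (𝟙 (Reach? n d c)) (λ e → 𝟙 (c ⟶? e) * h e)) ⟩
    ∑ (darts G) (λ c → 𝟙 (Reach? n d c) * B h c)
      ≤⟨ ∑-reach≤B^ n (λ c → ∑-nonNeg (darts G) (λ e → *-nonNeg (0≤𝟙 (c ⟶? e)) (0≤h e))) d ⟩
    B^ n (B h) d ∎
    where
    open ≤-Reasoning
    0≤term : ∀ e c → 0ℚ ≤ 𝟙 (Reach? n d c) * (𝟙 (c ⟶? e) * h e)
    0≤term e c = *-nonNeg (0≤𝟙 (Reach? n d c)) (*-nonNeg (0≤𝟙 (c ⟶? e)) (0≤h e))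
    through : ∀ e → 𝟙 (Reach? (suc n) d e) * h e ≤
              ∑ (darts G) (λ c → 𝟙 (Reach? n d c) * (𝟙 (c ⟶? e) * h e))
    through e with Reach? (suc n) d e
    ... | no _ = ≤-trans (≤-reflexive (*-zeroˡ (h e))) (∑-nonNeg (darts G) (0≤term e))
    ... | yes (c , r , w) = begin
      1ℚ * h e                                          ≡⟨ *-identityˡ (1ℚ * h e) ⟨
      1ℚ * (1ℚ * h e)                                   ≡⟨ cong₂ (λ a b → a * (b * h e)) (𝟙-yes (Reach? n d c) r) (𝟙-yes (c ⟶? e) w) ⟨
      𝟙 (Reach? n d c) * (𝟙 (c ⟶? e) * h e)             ≤⟨ term≤∑ (0≤term e) (∈-darts c) ⟩
      ∑ (darts G) (λ c → 𝟙 (Reach? n d c) * (𝟙 (c ⟶? e) * h e)) ∎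

  ∑-reach≤ : ∀ n {h : Dart G → ℚ} {M} → (∀ e → h e ≤ M) → ∀ d →
             ∑ (darts G) (λ e → 𝟙 (Reach? n d e) * (M - h e)) ≤ κ ^ n * M - B^ n h d
  ∑-reach≤ n {h} {M} h≤M d = ≤-trans (∑-reach≤B^ n (λ e → p≤q⇒0≤q-p (h≤M e)) d)
    (≤-reflexive (trans (B^-distrib-- n (λ _ → M) h d) (cong (_- B^ n h d) (B^-const n M d))))

  upper : ∀ n {h : Dart G → ℚ} {M} → (∀ e → h e ≤ M) → ∀ d → B^ n h d ≤ κ ^ n * M
  upper n {h} {M} h≤M d = 0≤q-p⇒p≤q (≤-trans
    (∑-nonNeg (darts G) (λ e → *-nonNeg (0≤𝟙 (Reach? n d e)) (p≤q⇒0≤q-p (h≤M e))))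
    (∑-reach≤ n h≤M d))

  -- Once every dart is reached, κ ^ n M - `B^ n h d` is at least the full sum of `M - h`. As `h`
  -- has sum zero, this is the sum of the constant `M`, and the single term at `d` already
  -- contributes `M`.
  upper-mixing : ∀ n → (∀ d e → Reach n d e) → ∀ {h : Dart G → ℚ} {M} → ∑ (darts G) h ≡ 0ℚ → 0ℚ ≤ M →
                 (∀ e → h e ≤ M) → ∀ d → B^ n h d ≤ κ ^ n * M - M
  upper-mixing n reach {h} {M} ∑h≡0 0≤M h≤M d = 0≤q-p⇒p≤q (begin
    0ℚ                                                       ≡⟨ +-inverseʳ M ⟨
    M - M                                                    ≤⟨ +-monoˡ-≤ (- M) (term≤∑ {f = λ _ → M} (λ _ → 0≤M) (∈-darts d)) ⟩
    ∑ (darts G) (λ _ → M) - M                                ≡⟨ cong (_- M) (+-identityʳ (∑ (darts G) (λ _ → M))) ⟨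
    ∑ (darts G) (λ _ → M) - 0ℚ - M                           ≡⟨ cong (λ z → ∑ (darts G) (λ _ → M) - z - M) ∑h≡0 ⟨
    ∑ (darts G) (λ _ → M) - ∑ (darts G) h - M                ≡⟨ cong (_- M) (∑-distrib-- (darts G) (λ _ → M) h) ⟨
    ∑ (darts G) (λ e → M - h e) - M                          ≡⟨ cong (_- M) (∑-cong (darts G) (λ e → trans
                                                                  (cong (_* (M - h e)) (𝟙-yes (Reach? n d e) (reach d e)))
                                                                  (*-identityˡ (M - h e)))) ⟨
    ∑ (darts G) (λ e → 𝟙 (Reach? n d e) * (M - h e)) - M     ≤⟨ +-monoˡ-≤ (- M) (∑-reach≤ n h≤M d) ⟩
    κ ^ n * M - B^ n h d - M                                 ≡⟨ solve 3 (λ a b m → a :- b :- m := a :- m :- b) refl (κ ^ n * M) (B^ n h d) M ⟩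
    κ ^ n * M - M - B^ n h d                                 ∎)
    where open ≤-Reasoning

  B^-neg : ∀ n (h : Dart G → ℚ) d → B^ n (λ e → - h e) d ≡ - B^ n h d
  B^-neg n h d = begin
    B^ n (λ e → - h e) d                 ≡⟨ B^-cong n (λ e → +-identityˡ (- h e)) d ⟨
    B^ n (λ e → 0ℚ - h e) d              ≡⟨ B^-distrib-- n (λ _ → 0ℚ) h d ⟩
    B^ n (λ _ → 0ℚ) d - B^ n h d         ≡⟨ cong (_- B^ n h d) (trans (B^-const n 0ℚ d) (*-zeroʳ (κ ^ n))) ⟩
    0ℚ - B^ n h d                        ≡⟨ +-identityˡ (- B^ n h d) ⟩
    - B^ n h d                           ∎
    where open ≡-Reasoning

  ∣B^∣≤ : ∀ n {h : Dart G → ℚ} {M} → (∀ e → ∣ h e ∣ ≤ M) → ∀ d → ∣ B^ n h d ∣ ≤ κ ^ n * M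
  ∣B^∣≤ n {h} h≤M d = ∣∣-lub
    (upper n (λ e → ≤-trans (p≤∣p∣ (h e)) (h≤M e)) d)
    (subst (_≤ _) (B^-neg n h d) (upper n (λ e → ≤-trans (-p≤∣p∣ (h e)) (h≤M e)) d))

  ∣B^∣-mixing : ∀ n → (∀ d e → Reach n d e) → ∀ {h : Dart G → ℚ} {M} → ∑ (darts G) h ≡ 0ℚ →
                (∀ e → ∣ h e ∣ ≤ M) → ∀ d → ∣ B^ n h d ∣ ≤ κ ^ n * M - M
  ∣B^∣-mixing n reach {h} {M} ∑h≡0 h≤M d = ∣∣-lub
    (upper-mixing n reach ∑h≡0 0≤M (λ e → ≤-trans (p≤∣p∣ (h e)) (h≤M e)) d)
    (subst (_≤ _) (B^-neg n h d) (upper-mixing n reach ∑-h≡0 0≤M (λ e → ≤-trans (-p≤∣p∣ (h e)) (h≤M e)) d))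
    where
    0≤M : 0ℚ ≤ M
    0≤M = ≤-trans (0≤∣p∣ (h d)) (h≤M d)
    ∑-h≡0 : ∑ (darts G) (λ e → - h e) ≡ 0ℚ
    ∑-h≡0 = begin
      ∑ (darts G) (λ e → - h e)          ≡⟨ ∑-cong (darts G) (λ e → sym (+-identityˡ (- h e))) ⟩
      ∑ (darts G) (λ e → 0ℚ - h e)       ≡⟨ ∑-distrib-- (darts G) (λ _ → 0ℚ) h ⟩
      ∑ (darts G) (λ _ → 0ℚ) - ∑ (darts G) h
                                         ≡⟨ cong₂ _-_ (∑-zero (darts G)) ∑h≡0 ⟩
      0ℚ                                 ∎
      where open ≡-Reasoning

  1≤κ : 1ℚ ≤ κ
  1≤κ = ι-mono {1} {q} (ℕ.+-cancelʳ-≤ 1 1 q (ℕ.≤-trans (ℕ.s≤s (ℕ.s≤s ℕ.z≤n)) 3≤q+1))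

  module _ (k : ℕ) (reach : ∀ d e → Reach (suc k) d e) {C β : ℚ} (0<C : 0ℚ < C)
    (0≤β : 0ℚ ≤ β) (β≤1 : β ≤ 1ℚ) (β^C≡1 : β ^ suc k * C ≡ 1ℚ)
    (rate : κ ^ suc k - 1ℚ ≤ κ ^ suc k * β ^ suc k) where

    private
      open ≤-Reasoning

      -- Induction step in strides of `suc k`. Below the first stride the crude bound κ ^ r M
      -- suffices, because `C * β ^ r` is at least `C * β ^ suc k`, which is 1; later a full stride
      -- gains the factor β ^ `suc k`.
      step : ∀ r {h : Dart G → ℚ} {M} → ∑ (darts G) h ≡ 0ℚ → (∀ e → ∣ h e ∣ ≤ M) →
             (∀ {s} → s ℕ.< r → ∀ d → ∣ B^ s h d ∣ ≤ κ ^ s * (C * β ^ s * M)) →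
             ∀ d → ∣ B^ r h d ∣ ≤ κ ^ r * (C * β ^ r * M)
      step r {h} {M} ∑h≡0 h≤M rec d with suc k ℕ.≤? r
      ... | no k≰r = begin
        ∣ B^ r h d ∣                      ≤⟨ ∣B^∣≤ r h≤M d ⟩
        κ ^ r * M                         ≡⟨ cong (κ ^ r *_) (*-identityˡ M) ⟨
        κ ^ r * (1ℚ * M)                  ≡⟨ cong (λ z → κ ^ r * (z * M)) (trans (*-comm C (β ^ suc k)) β^C≡1) ⟨
        κ ^ r * (C * β ^ suc k * M)       ≤⟨ *-monoˡ-≤-nonNeg (κ ^ r) {{nonNegative (^-nonNeg 0≤κ r)}}
                                               (*-monoʳ-≤-nonNeg M {{nonNegative 0≤M}}
                                                 (*-monoˡ-≤-nonNeg C {{nonNegative (<⇒≤ 0<C)}}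
                                                   (^-antitone 0≤β β≤1 (ℕ.<⇒≤ (ℕ.≰⇒> k≰r))))) ⟩
        κ ^ r * (C * β ^ r * M)           ∎
        where
        0≤M : 0ℚ ≤ M
        0≤M = ≤-trans (0≤∣p∣ (h d)) (h≤M d)
      ... | yes k≤r = subst (λ r → ∣ B^ r h d ∣ ≤ κ ^ r * (C * β ^ r * M)) (ℕ.m∸n+n≡m k≤r) (begin
        ∣ B^ (s ℕ.+ suc k) h d ∣                  ≡⟨ cong ∣_∣ (B^-+ s (suc k) h d) ⟩
        -- Mixing is applied to `B^ s h`, which still has sum zero, with the induction hypothesis as
        -- its uniform bound.
        ∣ B^ (suc k) (B^ s h) d ∣                 ≤⟨ ∣B^∣-mixing (suc k) reach (∑-B^≡0 s ∑h≡0) s-bound d ⟩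
        K * M′ - M′                               ≡⟨ solve 2 (λ K M → K :* M :- M := (K :- con 1ℚ) :* M) refl K M′ ⟩
        (K - 1ℚ) * M′                             ≤⟨ *-monoʳ-≤-nonNeg M′ {{nonNegative (≤-trans (0≤∣p∣ (B^ s h d)) (s-bound d))}} rate ⟩
        K * β ^ suc k * M′                        ≡⟨ solve 6 (λ K b c k e m → K :* b :* (k :* (c :* e :* m)) := k :* K :* (c :* (e :* b) :* m))
                                                       refl K (β ^ suc k) C (κ ^ s) (β ^ s) M ⟩
        κ ^ s * K * (C * (β ^ s * β ^ suc k) * M) ≡⟨ cong₂ (λ a b → a * (C * b * M)) (^-homo-* κ s (suc k)) (^-homo-* β s (suc k)) ⟨
        κ ^ (s ℕ.+ suc k) * (C * β ^ (s ℕ.+ suc k) * M) ∎)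
        where
        s = r ℕ.∸ suc k
        K = κ ^ suc k
        M′ = κ ^ s * (C * β ^ s * M)
        s-bound : ∀ d → ∣ B^ s h d ∣ ≤ M′
        s-bound = rec (ℕ.∸-monoʳ-< {r} {suc k} {0} (ℕ.s≤s ℕ.z≤n) k≤r)

    B^-decay : ∀ r {h : Dart G → ℚ} {M} → ∑ (darts G) h ≡ 0ℚ → (∀ e → ∣ h e ∣ ≤ M) →
               ∀ d → ∣ B^ r h d ∣ ≤ κ ^ r * (C * β ^ r * M)
    B^-decay r {h} {M} ∑h≡0 h≤M =
      <-rec (λ r → ∀ d → ∣ B^ r h d ∣ ≤ κ ^ r * (C * β ^ r * M)) (λ r → step r ∑h≡0 h≤M) r

  abstract
    decay : ∃ λ C → ∃ λ β → 0ℚ < C × ¾ ≤ β × β < 1ℚ ×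
      (∀ r {h : Dart G → ℚ} {M} → ∑ (darts G) h ≡ 0ℚ → (∀ e → ∣ h e ∣ ≤ M) →
        ∀ d → ∣ B^ r h d ∣ ≤ κ ^ r * (C * β ^ r * M))
    decay = from-rate (contraction-rate 1≤κ k)
      where
      k : ℕ
      k = proj₁ mixing
      Decay : ℚ → ℚ → Set
      Decay C β = 0ℚ < C × ¾ ≤ β × β < 1ℚ ×
        (∀ r {h : Dart G → ℚ} {M} → ∑ (darts G) h ≡ 0ℚ → (∀ e → ∣ h e ∣ ≤ M) →
          ∀ d → ∣ B^ r h d ∣ ≤ κ ^ r * (C * β ^ r * M))
      from-rate : (∃ λ β → ¾ ≤ β × β < 1ℚ × κ ^ suc k - 1ℚ ≤ κ ^ suc k * β ^ suc k) →
                  ∃ λ C → ∃ λ β → Decay C β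
      -- `C` is the inverse of β ^ `suc k`, the value that makes the bound trivial for exponents
      -- below `suc k`.
      from-rate (β , ¾≤β , β<1 , rate) = from-inverse (divide (^-pos 0<β (suc k)) (positive⁻¹ 1ℚ))
        where
        0<β : 0ℚ < β
        0<β = <-≤-trans (from-yes (0ℚ <? ¾)) ¾≤β
        from-inverse : (∃ λ C → 0ℚ < C × β ^ suc k * C ≡ 1ℚ) → ∃ λ C → ∃ λ β → Decay C β
        from-inverse (C , 0<C , β^C≡1) = C , β , 0<C , ¾≤β , β<1 ,
          B^-decay k (proj₂ mixing) 0<C (<⇒≤ 0<β) (<⇒≤ β<1) β^C≡1 rate

-- Distance in the tree of finite words, each word being adjacent to its one-letter extensions.
module WordTree {A : Set} (_≟_ : DecidableEquality A) where

  open import Data.List.Properties using (++-assoc; ++-cancelˡ; ++-identityʳ; length-++; ∷-injectiveˡ)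
  open import Data.Nat using (_+_)
  open import Data.Nat.Properties using (+-comm)

  dist : List A → List A → ℕ
  dist []       ys       = length ys
  dist (x ∷ xs) []       = suc (length xs)
  dist (x ∷ xs) (y ∷ ys) with x ≟ y
  ... | yes _ = dist xs ys
  ... | no  _ = suc (length xs) + suc (length ys)

  dist-sym : ∀ xs ys → dist xs ys ≡ dist ys xs
  dist-sym []       []       = refl
  dist-sym []       (y ∷ ys) = refl
  dist-sym (x ∷ xs) []       = refl
  dist-sym (x ∷ xs) (y ∷ ys) with x ≟ y | y ≟ x
  ... | yes _    | yes _    = dist-sym xs ys
  ... | yes refl | no y≢    = contradiction refl y≢
  ... | no x≢    | yes refl = contradiction refl x≢
  ... | no _     | no _     = +-comm (suc (length xs)) (suc (length ys))

  dist≡0 : ∀ xs ys → dist xs ys ≡ 0 → xs ≡ ys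
  dist≡0 []       []       _  = refl
  dist≡0 (x ∷ xs) (y ∷ ys) eq with x ≟ y
  ... | yes refl = cong (x ∷_) (dist≡0 xs ys eq)

  dist-++ : ∀ xs ys → dist xs (xs ++ ys) ≡ length ys
  dist-++ []       ys = refl
  dist-++ (x ∷ xs) ys with x ≟ x
  ... | yes _  = dist-++ xs ys
  ... | no x≢x = contradiction refl x≢x

  dist-refl : ∀ xs → dist xs xs ≡ 0
  dist-refl xs = subst (λ ys → dist xs ys ≡ 0) (++-identityʳ xs) (dist-++ xs [])

  length-∷ʳ : ∀ xs (d : A) → length (xs ∷ʳ d) ≡ suc (length xs)
  length-∷ʳ xs d = trans (length-++ xs) (+-comm (length xs) 1)

  -- The branch starting with `xs ∷ʳ d` is the only place to which this child is nearer than its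
  -- parent. The facts below about nearer neighbours all rest on this dichotomy.
  farther-or-prefix : ∀ xs d ys → dist (xs ∷ʳ d) ys ≡ suc (dist xs ys) ⊎ (∃ λ zs → ys ≡ xs ++ d ∷ zs)
  farther-or-prefix []       d []       = inj₁ refl
  farther-or-prefix []       d (y ∷ ys) with d ≟ y
  ... | yes refl = inj₂ (ys , refl)
  ... | no _     = inj₁ refl
  farther-or-prefix (x ∷ xs) d []       = inj₁ (cong suc (length-∷ʳ xs d))
  farther-or-prefix (x ∷ xs) d (y ∷ ys) with x ≟ y
  ... | yes refl = map₂ (λ (zs , eq) → zs , cong (x ∷_) eq) (farther-or-prefix xs d ys)
  ... | no _     = inj₁ (cong (λ k → suc k + suc (length ys)) (length-∷ʳ xs d))

  prefix⇒closer : ∀ xs d zs → dist xs (xs ++ d ∷ zs) ≡ suc (dist (xs ∷ʳ d) (xs ++ d ∷ zs))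
  prefix⇒closer xs d zs = trans (dist-++ xs (d ∷ zs)) (cong suc (sym
    (trans (cong (dist (xs ∷ʳ d)) (sym (++-assoc xs (d ∷ []) zs))) (dist-++ (xs ∷ʳ d) zs))))

  m≢2+m : ∀ {m} → m ≢ suc (suc m)
  m≢2+m ()

  closer⇒prefix : ∀ xs d ys → dist xs ys ≡ suc (dist (xs ∷ʳ d) ys) → ∃ λ zs → ys ≡ xs ++ d ∷ zs
  closer⇒prefix xs d ys closer with farther-or-prefix xs d ys
  ... | inj₁ farther = contradiction (trans closer (cong suc farther)) m≢2+m
  ... | inj₂ prefix  = prefix

  closer-children : ∀ xs {d e ys} → dist xs ys ≡ suc (dist (xs ∷ʳ d) ys) →
                    dist xs ys ≡ suc (dist (xs ∷ʳ e) ys) → d ≡ e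
  closer-children xs {d} {e} {ys} p q with closer⇒prefix xs d ys p | closer⇒prefix xs e ys q
  ... | zs , refl | zs′ , eq = ∷-injectiveˡ (++-cancelˡ xs (d ∷ zs) (e ∷ zs′) eq)

  -- A word below the grandchild is also below the child, and then the child is nearer to it than
  -- the parent.
  ¬closer-parent-and-child : ∀ xs {d e ys} → dist (xs ∷ʳ d) ys ≡ suc (dist xs ys) →
                             dist (xs ∷ʳ d) ys ≢ suc (dist (xs ∷ʳ d ∷ʳ e) ys)
  ¬closer-parent-and-child xs {d} {e} {ys} p q with closer⇒prefix (xs ∷ʳ d) e ys q
  ... | zs , refl = m≢2+m (trans
    (subst (λ ys → dist xs ys ≡ suc (dist (xs ∷ʳ d) ys)) (sym (++-assoc xs (d ∷ []) (e ∷ zs))) (prefix⇒closer xs d (e ∷ zs)))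
    (cong suc p))

-- The metric of the universal cover.

module CoverTree (G : Graph) (root : V G) where
  open import Data.List.Properties using (unfold-reverse; reverse-injective; reverse-++; reverse-involutive; ∷-injectiveʳ; ++-assoc)
  open import Data.Nat using (_≤_)
  open import Data.Nat.Properties using (suc-injective; ≤-trans; ≤-reflexive; n≤1+n; ≤-antisym)
  open import Relation.Binary.Construct.Closure.ReflexiveTransitive using (Star; ε; _◅_)
  open UniversalCover G root
  open DartWalks G
  open WordTree _≟ᴰ_

  -- Steps are stored last first; reversed, common initial paths become common prefixes.
  word : Ṽ → List (Dart G)
  word x = reverse (steps x)

  -- Distance in the tree of all words. It agrees with `δ` because the shortest way between two
  -- nonbacktracking words never leaves the nonbacktracking words.
  ρ : Ṽ → Ṽ → ℕ
  ρ x z = dist (word x) (word z)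

  steps-injective : ∀ {x y} → steps x ≡ steps y → x ≡ y
  steps-injective {path _ _} {path _ _} refl = refl

  word-child : ∀ {x y d} → steps y ≡ d ∷ steps x → word y ≡ word x ∷ʳ d
  word-child {x} {y} {d} eq = trans (cong reverse eq) (unfold-reverse d (steps x))

  ρ-sym : ∀ x y → ρ x y ≡ ρ y x
  ρ-sym x y = dist-sym (word x) (word y)

  ρ-refl : ∀ x → ρ x x ≡ 0
  ρ-refl x = dist-refl (word x)

  ρ≡0 : ∀ {x y} → ρ x y ≡ 0 → x ≡ y
  ρ≡0 {x} {y} eq = steps-injective (reverse-injective (dist≡0 (word x) (word y) eq))

  ~-sym : ∀ {x y} → x ~ y → y ~ x
  ~-sym (d , eqs) = d , swap eqs

  ρ-child : ∀ {x y d} z → steps y ≡ d ∷ steps x → ρ y z ≡ suc (ρ x z) ⊎ ρ x z ≡ suc (ρ y z)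
  ρ-child {x} {y} {d} z eq rewrite word-child {x} {y} eq with farther-or-prefix (word x) d (word z)
  ... | inj₁ farther    = inj₁ farther
  ... | inj₂ (zs , eq′) rewrite eq′ = inj₂ (prefix⇒closer (word x) d zs)

  ρ-step : ∀ {x y} z → x ~ y → ρ y z ≡ suc (ρ x z) ⊎ ρ x z ≡ suc (ρ y z)
  ρ-step {x} {y} z (d , inj₁ eq) = ρ-child {x} {y} z eq
  ρ-step {x} {y} z (d , inj₂ eq) = swap (ρ-child {y} {x} z eq)

  ρ-lipschitz : ∀ {x y} z → x ~ y → ρ x z ≤ suc (ρ y z)
  ρ-lipschitz {x} {y} z x~y with ρ-step {x} {y} z x~y
  ... | inj₁ eq = ≤-trans (n≤1+n _) (≤-trans (≤-reflexive (sym eq)) (n≤1+n _))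
  ... | inj₂ eq = ≤-reflexive eq

  -- Absence of cycles. Two nearer children continue with the same letter, a vertex has only one
  -- parent, and a parent and a child cannot both be nearer.
  closer-unique : ∀ {x y y′ z} → x ~ y → x ~ y′ → ρ x z ≡ suc (ρ y z) → ρ x z ≡ suc (ρ y′ z) → y ≡ y′
  closer-unique {x} {y} {y′} {z} (d , inj₁ eq) (d′ , inj₁ eq′) p p′
    rewrite word-child {x} {y} eq | word-child {x} {y′} eq′ with closer-children (word x) p p′
  ... | refl = steps-injective (trans eq (sym eq′))
  closer-unique (d , inj₂ eq) (d′ , inj₂ eq′) p p′ = steps-injective (∷-injectiveʳ (trans (sym eq) eq′))
  closer-unique {x} {y} {y′} {z} (d , inj₁ eq) (d′ , inj₂ eq′) p p′
    rewrite word-child {x} {y} eq | word-child {y′} {x} eq′ = contradiction p (¬closer-parent-and-child (word y′) p′)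
  closer-unique {x} {y} {y′} {z} (d , inj₂ eq) (d′ , inj₁ eq′) p p′
    rewrite word-child {x} {y′} eq′ | word-child {y} {x} eq = contradiction p′ (¬closer-parent-and-child (word y) p)

  nonBacktracking-suffix : ∀ ds {es} → IsNonBacktracking (ds ++ es) → IsNonBacktracking es
  nonBacktracking-suffix []       nb           = nb
  nonBacktracking-suffix (d ∷ ds) (_ , _ , nb) = nonBacktracking-suffix ds nb

  -- The extension of `x` by `d` is nonbacktracking since its list of steps is a suffix of that of
  -- `z`.
  closer-child : ∀ x z {d zs} → word z ≡ word x ++ d ∷ zs → ∃ λ y → x ~ y × ρ x z ≡ suc (ρ y z)
  closer-child x z@(path _ nb) {d} {zs} eq = y , (d , inj₁ refl) , closer
    where
    steps-z : steps z ≡ reverse zs ++ d ∷ steps x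
    steps-z = begin
      steps z                              ≡⟨ reverse-involutive (steps z) ⟨
      reverse (word z)                     ≡⟨ cong reverse eq ⟩
      reverse (word x ++ d ∷ zs)           ≡⟨ reverse-++ (word x) (d ∷ zs) ⟩
      reverse (d ∷ zs) ++ reverse (word x) ≡⟨ cong₂ _++_ (unfold-reverse d zs) (reverse-involutive (steps x)) ⟩
      (reverse zs ∷ʳ d) ++ steps x         ≡⟨ ++-assoc (reverse zs) (d ∷ []) (steps x) ⟩
      reverse zs ++ d ∷ steps x            ∎
      where open ≡-Reasoning
    y : Ṽ
    y = path (d ∷ steps x) (nonBacktracking-suffix (reverse zs) (subst IsNonBacktracking steps-z nb))
    closer : ρ x z ≡ suc (ρ y z)
    closer rewrite eq | unfold-reverse d (steps x) = prefix⇒closer (word x) d zs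

  -- One goes down when `z` lies below `x`, and up to the parent otherwise.
  closer-exists : ∀ x z {k} → ρ x z ≡ suc k → ∃ λ y → x ~ y × ρ x z ≡ suc (ρ y z)
  closer-exists (path [] nb) z eq with uncons (word z) eq
    where
    uncons : ∀ (ds : List (Dart G)) {k} → length ds ≡ suc k → ∃ λ e → ∃ λ es → ds ≡ e ∷ es
    uncons (e ∷ es) _ = e , es , refl
  ... | _ , _ , wz = closer-child (path [] nb) z wz
  closer-exists x@(path (d ∷ ds) nb) z eq with farther-or-prefix (reverse ds) d (word z)
  ... | inj₁ farther       = path ds (proj₂ (proj₂ nb)) , (d , inj₂ refl) , trans (cong (λ w → dist w (word z)) (unfold-reverse d ds)) farther
  ... | inj₂ (zs , prefix) with zs | trans prefix (trans (sym (++-assoc (reverse ds) (d ∷ []) zs)) (cong (_++ zs) (sym (unfold-reverse d ds))))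
  ...   | e ∷ zs′ | eq′ = closer-child x z eq′
  -- Here `z` has the same word as `x`, against the positive distance.
  ...   | []      | eq′ = contradiction (trans (sym eq) (trans (cong (dist (word x)) eq′) (dist-++ (word x) []))) λ ()

  ρ≤walkLength : ∀ {x z} (w : Star _~_ x z) → ρ x z ≤ walkLength w
  ρ≤walkLength {x} ε = ≤-reflexive (ρ-refl x)
  ρ≤walkLength {x} {z} (_◅_ {j = y} a w) = ≤-trans (ρ-lipschitz {x} {y} z a) (s≤s (ρ≤walkLength w))

  shortest : ∀ k {x z} → ρ x z ≡ k → ∃ λ (w : Star _~_ x z) → walkLength w ≡ k
  shortest zero {x} {z} eq with ρ≡0 {x} {z} eq
  ... | refl = ε , refl
  shortest (suc k) {x} {z} eq with closer-exists x z eq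
  ... | y , x~y , closer with shortest k {y} {z} (suc-injective (trans (sym closer) eq))
  ...   | w , len = x~y ◅ w , cong suc len

  ρ⇒δ : ∀ {x z k} → ρ x z ≡ k → (x , z) δ≡ k
  ρ⇒δ {k = k} eq = shortest k eq , λ w → subst (_≤ walkLength w) eq (ρ≤walkLength w)

  δ⇒ρ : ∀ {x z k} → (x , z) δ≡ k → ρ x z ≡ k
  δ⇒ρ ((w , len) , minimal) with shortest _ refl
  ... | w′ , len′ = ≤-antisym (≤-trans (ρ≤walkLength w) (≤-reflexive len)) (≤-trans (minimal w′) (≤-reflexive len′))

-- Repetition-free images of lists.

module UniqueMap where

  open import Data.List.Relation.Unary.All as All using (All; []; _∷_)
  import Data.List.Relation.Unary.All.Properties as All
  open import Data.List.Relation.Unary.AllPairs using ([]; _∷_)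
  open import Data.List.Relation.Unary.Unique.Propositional using (Unique)

  -- Injectivity is asked for only where `P` holds: the map `next x` used later sends all darts that
  -- do not start at `π x` to the same vertex.
  unique-map : ∀ {A B : Set} {P : A → Set} {f : A → B} → (∀ {x y} → P x → P y → f x ≡ f y → x ≡ y) →
               ∀ {xs} → All P xs → Unique xs → Unique (map f xs)
  unique-map inj []       []         = []
  unique-map inj (p ∷ ps) (x∉ ∷ xs!) =
    All.map⁺ (All.zipWith (λ (p′ , x≢) eq → x≢ (inj p p′ eq)) (ps , x∉)) ∷ unique-map inj ps xs!

-- Lifting darts to the cover, and listing the horocycle pieces.

module HorocyclePieces (G : Graph) (root : V G) where

  open import Data.Empty using (⊥-elim-irr)
  open import Data.Integer using (+_)
  open import Data.List.Properties using (∷-injectiveˡ; ∷-injectiveʳ; map-++; map-∘)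
  open import Data.List.Membership.Propositional using (_∈_; find)
  open import Data.List.Membership.Propositional.Properties using (∈-map⁺; ∈-map⁻; ∈-filter⁺; ∈-filter⁻; ∈-concatMap⁺; ∈-concatMap⁻)
  open import Data.List.Relation.Unary.All as All using (All; []; _∷_)
  import Data.List.Relation.Unary.All.Properties as All
  open import Data.List.Relation.Unary.AllPairs using ([]; _∷_)
  open import Data.List.Relation.Unary.Any as Any using (here)
  open import Data.List.Relation.Unary.Unique.Propositional using (Unique)
  open import Data.List.Relation.Unary.Unique.Propositional.Properties using (++⁺; filter⁺)
  import Data.Maybe.Relation.Unary.All as Maybe
  open import Data.Nat using (_≤_; _+_; _∸_)
  open import Data.Rational as ℚ using (ℚ)
  import Data.Rational.Properties as ℚ
  open import Data.Unit using (tt)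
  open import Function using (_⇔_; mk⇔)
  open import Relation.Nullary.Decidable using (recompute)
  open UniversalCover G root
  open Sums
  open DartWalks G
  open CoverTree G root
  open UniqueMap
  open WordTree _≟ᴰ_ using (m≢2+m)

  -- The step from x to y lies over the dart d of G.
  Over : Ṽ → Dart G → Ṽ → Set
  Over x d y = steps y ≡ d ∷ steps x ⊎ steps x ≡ inverse G d ∷ steps y

  over⇒~ : ∀ {x d y} → Over x d y → x ~ y
  over⇒~ {d = d} (inj₁ eq) = d , inj₁ eq
  over⇒~ {d = d} (inj₂ eq) = inverse G d , inj₂ eq

  ~⇒over : ∀ {x y} → x ~ y → ∃ λ d → Over x d y
  ~⇒over (d , inj₁ eq) = d , inj₁ eq
  ~⇒over {y = y} (d , inj₂ eq) = inverse G d , inj₂ (trans eq (cong (_∷ steps y) (sym (inverse-involutive d))))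

  over-sym : ∀ {x d y} → Over x d y → Over y (inverse G d) x
  over-sym {x} {d} (inj₁ eq) = inj₂ (trans eq (cong (_∷ steps x) (sym (inverse-involutive d))))
  over-sym (inj₂ eq) = inj₁ eq

  -- The proof stored in a path is irrelevant, so the equation is recovered by deciding it.
  last-step-source : ∀ {x d ds} → steps x ≡ d ∷ ds → source G d ≡ endpoint ds
  last-step-source {path _ nb} {d} {ds} refl = recompute (source G d Fin.≟ endpoint ds) (proj₁ nb)

  over-source : ∀ {x d y} → Over x d y → source G d ≡ π x
  over-source {x} {d} {y} (inj₁ eq) = last-step-source {y} eq
  over-source {x} {d} {y} (inj₂ eq) = trans (sym (target-inverse d)) (sym (cong endpoint eq))

  over-target : ∀ {x d y} → Over x d y → target G d ≡ π y
  over-target {x} {d} {y} (inj₁ eq) = sym (cong endpoint eq)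
  over-target {x} {d} {y} (inj₂ eq) = last-step-source {x} eq

  over-unique-label : ∀ {x d e y} → Over x d y → Over x e y → d ≡ e
  over-unique-label (inj₁ p) (inj₁ q) = ∷-injectiveˡ (trans (sym p) q)
  over-unique-label (inj₂ p) (inj₂ q) = inverse-injective (∷-injectiveˡ (trans (sym p) q))
  over-unique-label (inj₁ p) (inj₂ q) = contradiction (trans (cong length p) (cong (λ ds → suc (length ds)) q)) m≢2+m
  over-unique-label (inj₂ p) (inj₁ q) = contradiction (trans (cong length p) (cong (λ ds → suc (length ds)) q)) m≢2+m

  -- Otherwise the last two steps of `y` would be mutually inverse.
  ¬extend-and-retract : ∀ {x d y z} → steps y ≡ d ∷ steps x → steps x ≢ inverse G d ∷ steps z
  ¬extend-and-retract {path _ _} {d} {path _ nb} refl refl = ⊥-elim-irr (backtracks nb)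
    where
    backtracks : ∀ {d ds} → ¬ IsNonBacktracking (d ∷ inverse G d ∷ ds)
    backtracks {d} (_ , Maybe.just d≢ , _) = d≢ (sym (inverse-involutive d))

  over-unique-target : ∀ {x d y z} → Over x d y → Over x d z → y ≡ z
  over-unique-target (inj₁ p) (inj₁ q) = steps-injective (trans p (sym q))
  over-unique-target (inj₂ p) (inj₂ q) = steps-injective (∷-injectiveʳ (trans (sym p) q))
  over-unique-target {x} {d} {y} {z} (inj₁ p) (inj₂ q) = contradiction q (¬extend-and-retract {x} {d} {y} {z} p)
  over-unique-target {x} {d} {y} {z} (inj₂ p) (inj₁ q) = contradiction p (¬extend-and-retract {x} {d} {z} {y} q)

  -- The lift of `d` deletes the last step of `x` if `d` reverses it, and appends `d` otherwise.
  -- Together with the two uniqueness lemmas this says that `π` is a covering.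
  over-exists : ∀ x d → source G d ≡ π x → ∃ (Over x d)
  over-exists x@(path [] _) d src = path (d ∷ []) (src , Maybe.nothing , tt) , inj₁ refl
  over-exists x@(path (e ∷ es) nb) d src with d ≟ᴰ inverse G e
  ... | yes refl = path es (proj₂ (proj₂ nb)) , inj₂ (cong (_∷ es) (sym (inverse-involutive e)))
  ... | no d≢    = path (d ∷ e ∷ es) (src , Maybe.just d≢ , nb) , inj₁ refl

  -- next x d is x itself when d does not start at π x.
  next : Ṽ → Dart G → Ṽ
  next x d with source G d Fin.≟ π x
  ... | yes src = proj₁ (over-exists x d src)
  ... | no _    = x

  over-next : ∀ x d → source G d ≡ π x → Over x d (next x d)
  over-next x d src with source G d Fin.≟ π x
  ... | yes src′ = proj₂ (over-exists x d src′)
  ... | no ¬src  = contradiction src ¬src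

  -- Each vertex is paired with the dart by which it was entered, since that dart alone determines
  -- the admissible continuations.
  children : Ṽ × Dart G → List (Ṽ × Dart G)
  children (x , d) = map (λ e → next x e , e) (filter (d ⟶?_) (darts G))

  branch : Ṽ × Dart G → ℕ → List (Ṽ × Dart G)
  branch s zero    = s ∷ []
  branch s (suc n) = concatMap children (branch s n)

  -- Summing over the last generation replaces `g` by `B g`, which matches the recursion of `B^`.
  ∑-branch : ∀ s n (g : Dart G → ℚ) → ∑ (branch s n) (λ t → g (proj₂ t)) ≡ B^ n g (proj₂ s)
  ∑-branch s zero    g = ℚ.+-identityʳ (g (proj₂ s))
  ∑-branch s (suc n) g = begin
    ∑ (concatMap children (branch s n)) (λ t → g (proj₂ t))
      ≡⟨ ∑-concatMap (branch s n) children (λ t → g (proj₂ t)) ⟩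
    ∑ (branch s n) (λ t → ∑ (children t) (λ u → g (proj₂ u)))
      ≡⟨ ∑-cong (branch s n) (λ t → trans (∑-map (filter (proj₂ t ⟶?_) (darts G)) (λ e → next (proj₁ t) e , e) (λ u → g (proj₂ u)))
           (∑-filter (proj₂ t ⟶?_) (darts G) g)) ⟩
    ∑ (branch s n) (λ t → B g (proj₂ t))
      ≡⟨ ∑-branch s n (B g) ⟩
    B^ n (B g) (proj₂ s) ∎
    where open ≡-Reasoning

  -- The branch of the cover beyond an edge.

  module _ (a b : Ṽ) (d₀ : Dart G) (b→a : Over b d₀ a) where

    -- The vertices x separated from b by a, at distance n from a.
    Beyond : ℕ → Ṽ → Set
    Beyond n x = ρ x a ≡ n × ρ x b ≡ suc n

    -- The vertex `p` is the neighbour of `x` on the way back to `b`; for `n = 0` it is `b` itself.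
    EnteredBy : ℕ → Ṽ × Dart G → Set
    EnteredBy n (x , d) = Beyond n x × ∃ λ p → Over p d x × ρ p b ≡ n

    ρ-b≤1+ρ-a : ∀ x → ρ x b ≤ suc (ρ x a)
    ρ-b≤1+ρ-a x = subst₂ (λ k l → k ≤ suc l) (ρ-sym b x) (ρ-sym a x) (ρ-lipschitz {b} {a} x (over⇒~ {b} {d₀} {a} b→a))

    entered₀ : EnteredBy 0 (a , d₀)
    entered₀ = (ρ-refl a , ρab) , b , b→a , ρ-refl b
      where
      ρab : ρ a b ≡ 1
      ρab with ρ-step {b} {a} b (over⇒~ {b} {d₀} {a} b→a)
      ... | inj₁ eq = trans eq (cong suc (ρ-refl b))
      ... | inj₂ eq = contradiction (trans (sym (ρ-refl b)) eq) λ ()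

    -- The only neighbour of `x` nearer to `b` is `p`, which is reached by reversing `d`; hence the
    -- new vertex is farther from `b`. It is then farther from `a` too, as the distances to `a` and
    -- `b` differ by at most one.
    entered-step : ∀ {n x d e} → EnteredBy n (x , d) → d ⟶ e → EnteredBy (suc n) (next x e , e)
    entered-step {n} {x} {d} {e} ((ρxa , ρxb) , p , p→x , ρpb) (src , e≢) = (ρya , ρyb) , x , x→y , ρxb
      where
      y = next x e
      x→y : Over x e y
      x→y = over-next x e (trans (sym src) (over-target {p} {d} {x} p→x))
      x~y : x ~ y
      x~y = over⇒~ {x} {e} {y} x→y
      x→p : Over x (inverse G d) p
      x→p = over-sym {p} {d} {x} p→x
      ρyb : ρ y b ≡ suc (suc n)
      ρyb with ρ-step {x} {y} b x~y
      ... | inj₁ farther = trans farther (cong suc ρxb)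
      ... | inj₂ closer with closer-unique {x} {y} {p} {b} x~y (over⇒~ {x} {inverse G d} {p} x→p) closer (trans ρxb (cong suc (sym ρpb)))
      ...   | y≡p = contradiction (over-unique-label {x} {e} {inverse G d} {p} (subst (Over x e) y≡p x→y) x→p) e≢
      ρya : ρ y a ≡ suc n
      ρya with ρ-step {x} {y} a x~y
      ... | inj₁ farther = trans farther (cong suc ρxa)
      ... | inj₂ closer  = contradiction
              (ℕ.≤-trans (ℕ.≤-reflexive (sym ρyb)) (ℕ.≤-trans (ρ-b≤1+ρ-a y) (ℕ.≤-reflexive (trans (sym closer) ρxa))))
              (ℕ.<⇒≱ (ℕ.m≤n⇒m≤1+n ℕ.≤-refl))

    private
      tree : ℕ → List (Ṽ × Dart G)
      tree = branch (a , d₀)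

    children-entered : ∀ {n t} → EnteredBy n t → All (EnteredBy (suc n)) (children t)
    children-entered {n} {x , d} ent = All.map⁺ (All.map (λ {e} → entered-step {n} {x} {d} {e} ent) (All.all-filter (d ⟶?_) (darts G)))

    tree-entered : ∀ n → All (EnteredBy n) (tree n)
    tree-entered zero    = entered₀ ∷ []
    tree-entered (suc n) = go (tree-entered n)
      where
      go : ∀ {ts} → All (EnteredBy n) ts → All (EnteredBy (suc n)) (concatMap children ts)
      go []           = []
      go (ent ∷ ents) = All.++⁺ (children-entered ent) (go ents)

    -- Induction through the neighbour `x` of `y` nearer to `a`. The step from `x` to `y` does not
    -- reverse the entry into `x`: otherwise `y` would be `p`, at distance `n` from `b` instead of
    -- `n + 2`.
    tree-complete : ∀ n y → Beyond n y → ∃ λ e → (y , e) ∈ tree n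
    tree-complete zero y (ρya , _) with ρ≡0 {y} {a} ρya
    ... | refl = d₀ , here refl
    tree-complete (suc n) y (ρya , ρyb) with closer-exists y a ρya
    ... | x , y~x , closer = e , ∈-concatMap⁺ children (Any.map (λ { refl → y∈children }) xd∈)
      where
      ρxa : ρ x a ≡ n
      ρxa = ℕ.suc-injective (trans (sym closer) ρya)
      ρxb : ρ x b ≡ suc n
      ρxb with ρ-step {y} {x} b y~x
      ... | inj₂ eq = ℕ.suc-injective (trans (sym eq) ρyb)
      ... | inj₁ eq = contradiction
              (ℕ.≤-trans (ℕ.≤-reflexive (sym (trans eq (cong suc ρyb)))) (ℕ.≤-trans (ρ-b≤1+ρ-a x) (s≤s (ℕ.≤-reflexive ρxa))))
              (ℕ.<⇒≱ (ℕ.m≤n⇒m≤1+n ℕ.≤-refl))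
      d = proj₁ (tree-complete n x (ρxa , ρxb))
      xd∈ = proj₂ (tree-complete n x (ρxa , ρxb))
      ent : EnteredBy n (x , d)
      ent = All.lookup (tree-entered n) xd∈
      p = proj₁ (proj₂ ent)
      p→x = proj₁ (proj₂ (proj₂ ent))
      ρpb = proj₂ (proj₂ (proj₂ ent))
      e = proj₁ (~⇒over {x} {y} (~-sym {y} {x} y~x))
      x→y : Over x e y
      x→y = proj₂ (~⇒over {x} {y} (~-sym {y} {x} y~x))
      e≢ : e ≢ inverse G d
      e≢ eq = contradiction
        (trans (sym ρpb) (trans (cong (λ z → ρ z b) (over-unique-target {x} {inverse G d} {p} {y} (over-sym {p} {d} {x} p→x) (subst (λ e → Over x e y) eq x→y))) ρyb))
        m≢2+m
      d⟶e : d ⟶ e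
      d⟶e = trans (over-target {p} {d} {x} p→x) (sym (over-source {x} {e} {y} x→y)) , e≢
      y∈children : (y , e) ∈ children (x , d)
      y∈children = subst (λ z → (z , e) ∈ children (x , d))
        (over-unique-target {x} {e} {next x e} {y} (over-next x e (over-source {x} {e} {y} x→y)) x→y)
        (∈-map⁺ (λ e → next x e , e) (∈-filter⁺ (d ⟶?_) (∈-darts e) d⟶e))

    child⇒parent : ∀ {n x d t} → EnteredBy n (x , d) → t ∈ children (x , d) →
                   proj₁ t ~ x × ρ (proj₁ t) b ≡ suc (ρ x b)
    child⇒parent {n} {x} {d} ent@((_ , ρxb) , _) t∈ with ∈-map⁻ (λ e → next x e , e) t∈
    ... | e , e∈ , refl = ~-sym {x} {next x e} (over⇒~ {x} {e} {next x e} x→y)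
                        , trans (proj₂ (proj₁ (entered-step {n} {x} {d} {e} ent d⟶e))) (cong suc (sym ρxb))
      where
      d⟶e = proj₂ (∈-filter⁻ (d ⟶?_) {xs = darts G} e∈)
      x→y = over-next x e (trans (sym (proj₁ d⟶e)) (over-target {proj₁ (proj₂ ent)} {d} {x} (proj₁ (proj₂ (proj₂ ent)))))

    -- Siblings differ because they lie over different darts. Children of different vertices differ
    -- because the parent is the unique neighbour nearer to `b`.
    tree-unique : ∀ n → Unique (map proj₁ (tree n))
    tree-unique zero    = [] ∷ []
    tree-unique (suc n) = go (tree n) (tree-entered n) (tree-unique n)
      where
      next-injective : ∀ {x d e e′} → EnteredBy n (x , d) → d ⟶ e → d ⟶ e′ → next x e ≡ next x e′ → e ≡ e′
      next-injective {x} {d} {e} {e′} (_ , p , p→x , _) w w′ eq = over-unique-label {x} {e} {e′} {next x e} (over w)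
        (subst (Over x e′) (sym eq) (over w′))
        where
        over : ∀ {e} → d ⟶ e → Over x e (next x e)
        over {e} (src , _) = over-next x e (trans (sym src) (over-target {p} {d} {x} p→x))
      go : ∀ ts → All (EnteredBy n) ts → Unique (map proj₁ ts) → Unique (map proj₁ (concatMap children ts))
      go []             []           []         = []
      go ((x , d) ∷ ts) (ent ∷ ents) (x∉ ∷ ts!) = subst Unique (sym (map-++ proj₁ (children (x , d)) (concatMap children ts)))
        (++⁺ (subst Unique (map-∘ (filter (d ⟶?_) (darts G)))
               (unique-map {P = d ⟶_} (next-injective ent) (All.all-filter (d ⟶?_) (darts G)) (filter⁺ (d ⟶?_) darts-unique)))
             (go ts ents ts!) disjoint)
        where
        disjoint : ∀ {y} → ¬ (y ∈ map proj₁ (children (x , d)) × y ∈ map proj₁ (concatMap children ts))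
        disjoint {y} (y∈ , y∈′) with ∈-map⁻ proj₁ y∈ | ∈-map⁻ proj₁ y∈′
        ... | t , t∈ , refl | t′ , t′∈ , eq with find (∈-concatMap⁻ children {xs = ts} t′∈)
        ...   | (x′ , d′) , x′∈ , t′∈′ = All.lookup x∉ (∈-map⁺ proj₁ x′∈)
                (closer-unique {proj₁ t} {x} {x′} {b} (proj₁ up) (subst (_~ x′) (sym eq) (proj₁ up′))
                  (proj₂ up) (subst (λ y → ρ y b ≡ suc (ρ x′ b)) (sym eq) (proj₂ up′)))
          where
          up  = child⇒parent {n} {x} {d} ent t∈
          up′ = child⇒parent {n} {x′} {d′} (All.lookup ents x′∈) t′∈′

  -- Distances along a geodesic ray and the identification of the pieces.

  module _ (γ : Geodesic) where

    private
      v : ℕ → Ṽ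
      v n = vertex γ (+ n)

      v~v : ∀ n → v n ~ v (suc n)
      v~v n = subst (λ m → v n ~ v m) (ℕ.+-comm n 1) (consecutive γ (+ n))

      v≢v : ∀ n → v n ≢ v (suc (suc n))
      v≢v n = subst (λ m → v n ≢ v m) (ℕ.+-comm n 2) (nonBacktracking γ (+ n))

    -- Once the ray moves away from `x` it never turns back: the only neighbour nearer to `x` is the
    -- preceding vertex of the ray, and the geodesic does not backtrack.
    ray-recedes : ∀ {x r j} → ρ x (v r) ≡ j → ρ x (v (suc r)) ≡ suc j →
                  ∀ m → ρ x (v (m + r)) ≡ m + j × ρ x (v (suc m + r)) ≡ suc m + j
    ray-recedes p q zero = p , q
    ray-recedes {x} {r} {j} p q (suc m) with ray-recedes {x} p q m
    ... | near , far = far , farther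
      where
      u = v (m + r)
      u′ = v (suc m + r)
      u″ = v (suc (suc m) + r)
      back : ρ u′ x ≡ suc (ρ u x)
      back = trans (ρ-sym u′ x) (trans far (cong suc (trans (sym near) (ρ-sym x u))))
      farther : ρ x u″ ≡ suc (suc m) + j
      farther with ρ-step {u′} {u″} x (v~v (suc m + r))
      ... | inj₁ eq = trans (ρ-sym x u″) (trans eq (cong suc (trans (ρ-sym u′ x) far)))
      ... | inj₂ eq = contradiction
              (closer-unique {u′} {u} {u″} {x} (~-sym {u} {u′} (v~v (m + r))) (v~v (suc m + r)) back eq)
              (v≢v (m + r))

    ρ-ray : ∀ x i m → ρ x (v (m + i)) ≤ m + ρ x (v i)
    ρ-ray x i zero    = ℕ.≤-refl
    ρ-ray x i (suc m) = ℕ.≤-trans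
      (subst₂ (λ k l → k ≤ suc l) (ρ-sym (v (suc m + i)) x) (ρ-sym (v (m + i)) x)
        (ρ-lipschitz {v (suc m + i)} {v (m + i)} x (~-sym {v (m + i)} {v (suc m + i)} (v~v (m + i)))))
      (s≤s (ρ-ray x i m))

    module _ (r : ℕ) where

      private
        b→a : ∃ λ d → Over (v (suc r)) d (v r)
        b→a = ~⇒over {v (suc r)} {v r} (~-sym {v r} {v (suc r)} (v~v r))

      entryDart : Dart G
      entryDart = proj₁ b→a

      pieceTree : List (Ṽ × Dart G)
      pieceTree = branch (v r , entryDart) r

      -- By `ray-recedes` the distance from `x` to the n-th vertex is n for all n from `r` on, so
      -- the Busemann sequence is zero from there.
      beyond⇒𝓗 : ∀ {x} → Beyond (v r) (v (suc r)) entryDart (proj₂ b→a) r x → 𝓗 γ r x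
      beyond⇒𝓗 {x} (ρxa , ρxb) = (r , λ n r≤n → n ,
        ρ⇒δ {x} {v n} (subst (λ n → ρ x (v n) ≡ n) (ℕ.m∸n+n≡m r≤n) (proj₁ (ray-recedes {x} ρxa ρxb (n ∸ r)))) ,
        ℤ.+-inverseʳ (+ n)) , ρ⇒δ {x} {v r} ρxa

      -- The index `N + suc r` lies in the range where the Busemann sequence is zero. Going back `N`
      -- vertices along the ray bounds the distance to vertex `suc r` from below by `suc r`; one
      -- step from vertex `r` bounds it from above.
      𝓗⇒beyond : ∀ {x} → 𝓗 γ r x → Beyond (v r) (v (suc r)) entryDart (proj₂ b→a) r x
      𝓗⇒beyond {x} ((N , busemann) , sphere) = ρxa , ℕ.≤-antisym
        (subst (λ k → ρ x (v (suc r)) ≤ suc k) ρxa (ρ-ray x r 1))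
        (ℕ.+-cancelˡ-≤ N _ _ (subst (_≤ N + ρ x (v (suc r))) ρxn (ρ-ray x (suc r) N)))
        where
        ρxa : ρ x (v r) ≡ r
        ρxa = δ⇒ρ {x} {v r} sphere
        ρxn : ρ x (v (N + suc r)) ≡ N + suc r
        ρxn with busemann (N + suc r) (ℕ.m≤m+n N (suc r))
        ... | d , δ , eq = trans (δ⇒ρ {x} {v (N + suc r)} δ) (ℤ.+-injective (ℤ.i-j≡0⇒i≡j (+ d) (+ (N + suc r)) eq))

      ∈-piece : ∀ x → x ∈ map proj₁ pieceTree ⇔ 𝓗 γ r x
      ∈-piece x = mk⇔ to from
        where
        to : x ∈ map proj₁ pieceTree → 𝓗 γ r x
        to x∈ with ∈-map⁻ proj₁ x∈
        ... | t , t∈ , refl = beyond⇒𝓗 (proj₁ (All.lookup (tree-entered (v r) (v (suc r)) entryDart (proj₂ b→a) r) t∈))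
        from : 𝓗 γ r x → x ∈ map proj₁ pieceTree
        from h = ∈-map⁺ proj₁ (proj₂ (tree-complete (v r) (v (suc r)) entryDart (proj₂ b→a) r x (𝓗⇒beyond h)))

      piece-unique : Unique (map proj₁ pieceTree)
      piece-unique = tree-unique (v r) (v (suc r)) entryDart (proj₂ b→a) r

      -- Every listed vertex projects to the target of the dart by which it was entered.
      ∑-piece : ∀ (f : V G → ℚ) → ∑ (map proj₁ pieceTree) (λ x → f (π x)) ≡ B^ r (λ d → f (target G d)) entryDart
      ∑-piece f = begin
        ∑ (map proj₁ pieceTree) (λ x → f (π x))
          ≡⟨ ∑-map pieceTree proj₁ (λ x → f (π x)) ⟩
        ∑ pieceTree (λ t → f (π (proj₁ t)))
          ≡⟨ ∑-cong-All (tree-entered (v r) (v (suc r)) entryDart (proj₂ b→a) r) ⟩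
        ∑ pieceTree (λ t → f (target G (proj₂ t)))
          ≡⟨ ∑-branch (v r , entryDart) r (λ d → f (target G d)) ⟩
        B^ r (λ d → f (target G d)) entryDart ∎
        where
        open ≡-Reasoning
        ∑-cong-All : ∀ {ts} → All (EnteredBy (v r) (v (suc r)) entryDart (proj₂ b→a) r) ts →
                     ∑ ts (λ t → f (π (proj₁ t))) ≡ ∑ ts (λ t → f (target G (proj₂ t)))
        ∑-cong-All []                              = refl
        ∑-cong-All {(x , d) ∷ _} ((_ , p , p→x , _) ∷ ents) =
          cong₂ ℚ._+_ (cong f (sym (over-target {p} {d} {x} p→x))) (∑-cong-All ents)

-- Reciprocals, squares and rational approximants of reals.

module RationalFacts where

  open import Data.Rational
  open import Data.Rational.Properties
  import Data.Rational.Unnormalised as ℚᵘ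
  import Data.Rational.Unnormalised.Properties as ℚᵘ
  open import Data.Rational.Solver using (module +-*-Solver)
  open import Relation.Nullary.Decidable using (from-yes)
  open +-*-Solver
  open ℚ-Facts
  open Sums
  open Powers

  1/n*n≡1 : ∀ n .{{_ : ℕ.NonZero n}} → (ℤ.+ 1 / n) * ι n ≡ 1ℚ
  1/n*n≡1 (suc n) = toℚᵘ-injective (ℚᵘ.≃-trans (toℚᵘ-homo-* (ℤ.+ 1 / suc n) (ι (suc n)))
    (ℚᵘ.≃-trans (ℚᵘ.*-cong (toℚᵘ-fromℚᵘ (ℚᵘ.mkℚᵘ (ℤ.+ 1) n)) (toℚᵘ-ι (suc n)))
      (ℚᵘ.*≡* (trans (ℤ.*-identityʳ (ℤ.+ 1 ℤ.* ℤ.+ suc n)) (cong (λ k → ℤ.+ 1 ℤ.* ℤ.+ suc k) (sym (ℕ.*-identityʳ n)))))))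

  0≤1/n : ∀ n .{{_ : ℕ.NonZero n}} → 0ℚ ≤ ℤ.+ 1 / n
  0≤1/n n = nonNegative⁻¹ (ℤ.+ 1 / n) {{normalize-nonNeg 1 n}}

  ∣p∣*∣p∣≡p*p : ∀ p → ∣ p ∣ * ∣ p ∣ ≡ p * p
  ∣p∣*∣p∣≡p*p p with ∣p∣≡p∨∣p∣≡-p p
  ... | inj₁ eq = cong₂ _*_ eq eq
  ... | inj₂ eq = trans (cong₂ _*_ eq eq) (solve 1 (λ p → (:- p) :* (:- p) := p :* p) refl p)

  0≤p*p : ∀ p → 0ℚ ≤ p * p
  0≤p*p p = subst (0ℚ ≤_) (∣p∣*∣p∣≡p*p p) (*-nonNeg (0≤∣p∣ p) (0≤∣p∣ p))

  square-cancel-≤ : ∀ {p q} → 0ℚ ≤ q → p * p ≤ q * q → p ≤ q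
  square-cancel-≤ {p} {q} 0≤q p²≤q² with p ≤? q
  ... | yes p≤q = p≤q
  ... | no  p≰q = contradiction (begin-strict
          p * p     ≤⟨ p²≤q² ⟩
          q * q     ≤⟨ *-monoˡ-≤-nonNeg q {{nonNegative 0≤q}} (<⇒≤ q<p) ⟩
          q * p     <⟨ *-monoˡ-<-pos p {{positive (≤-<-trans 0≤q q<p)}} q<p ⟩
          p * p     ∎) (<-irrefl refl)
    where
    open ≤-Reasoning
    q<p : q < p
    q<p = ≰⇒> p≰q

  sqrtLow≤¾ : ∀ {a} → 0ℚ ≤ a → a ≤ ½ → ∀ n → sqrtLow a n ≤ ¾
  sqrtLow≤¾ {a} 0≤a a≤½ n = square-cancel-≤ {sqrtLow a n} {¾} (from-yes (0ℚ ≤? ¾))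
    (≤-trans (proj₁ (proj₂ (sqrt-bracket 0≤a n))) (≤-trans a≤½ (from-yes (½ ≤? ¾ * ¾))))

  -- Real sums are formed index by index, so rational estimates apply to each approximant
  -- separately.
  seq-sumℝ : ∀ {A : Set} (xs : List A) (g : A → ℝ) n → seq (sumℝ (map g xs)) n ≡ ∑ xs (λ x → seq (g x) n)
  seq-sumℝ []       g n = refl
  seq-sumℝ (x ∷ xs) g n = cong (seq (g x) n +_) (seq-sumℝ xs g n)

  seq-^ℝ : ∀ β r n → seq (fromℚ β ^ℝ r) n ≡ β ^ r
  seq-^ℝ β ℕ.zero    n = refl
  seq-^ℝ β (ℕ.suc r) n = cong (β *_) (seq-^ℝ β r n)

-- From the decay of dart functions to averages over horocycle pieces.

module HorocycleAverages (G : Graph) (connected : Connected G) (¬bipartite : ¬ Bipartite G)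
  (q : ℕ) (3≤q+1 : 3 ℕ.≤ q ℕ.+ 1) (regular : Regular G (q ℕ.+ 1)) where

  open import Data.Fin.Properties using (nonZeroIndex)
  open import Data.List.Properties using (length-tabulate)
  open import Data.List.Membership.Propositional.Properties using (∈-allFin)
  open import Function using (id)
  open import Data.Rational
  open import Data.Rational.Properties
  open import Data.Rational.Solver using (module +-*-Solver)
  open import Relation.Nullary.Decidable using (from-yes)
  open +-*-Solver
  open ℚ-Facts
  open Bounded
  open SqrtFacts
  open Sums
  open Powers
  open RationalFacts
  open DartWalks G
  open RegularGraph G q regular
  open Contraction G connected ¬bipartite q 3≤q+1 regular

  private
    C₀ : ℚ
    C₀ = proj₁ decay

  C β : ℚ
  -- The factor 2 pays for subtracting the mean: values of size at most M become at most 2 M.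
  C = ι 2 * C₀
  β = proj₁ (proj₂ decay)

  0<C : 0ℚ < C
  0<C = *-pos (from-yes (0ℚ <? ι 2)) (proj₁ (proj₂ (proj₂ decay)))

  ¾≤β : ¾ ≤ β
  ¾≤β = proj₁ (proj₂ (proj₂ (proj₂ decay)))

  0≤β : 0ℚ ≤ β
  0≤β = ≤-trans (from-yes (0ℚ ≤? ¾)) ¾≤β

  β<1 : β < 1ℚ
  β<1 = proj₁ (proj₂ (proj₂ (proj₂ (proj₂ decay))))

  module _ (root : V G) where

    open UniversalCover G root
    open HorocyclePieces G root

    private
      instance
        #V≢0 : ℕ.NonZero (#V G)
        #V≢0 = nonZeroIndex root
      vs = allFin (#V G)
      1/#V : ℚ
      1/#V = ℤ.+ 1 / #V G

    ∑-const : ∀ c → ∑ vs (λ _ → c) * 1/#V ≡ c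
    ∑-const c = begin
      ∑ vs (λ _ → c) * 1/#V                ≡⟨ cong (_* 1/#V) (∑-cong vs (λ _ → sym (*-identityˡ c))) ⟩
      ∑ vs (λ _ → 1ℚ * c) * 1/#V           ≡⟨ cong (_* 1/#V) (∑-*ʳ vs c (λ _ → 1ℚ)) ⟩
      ∑ vs (λ _ → 1ℚ) * c * 1/#V           ≡⟨ cong (λ z → z * c * 1/#V) (trans (∑-length vs) (cong ι (length-tabulate {n = #V G} id))) ⟩
      ι (#V G) * c * 1/#V                  ≡⟨ solve 3 (λ n c i → n :* c :* i := i :* n :* c) refl (ι (#V G)) c 1/#V ⟩
      1/#V * ι (#V G) * c                  ≡⟨ cong (_* c) (1/n*n≡1 (#V G)) ⟩
      1ℚ * c                               ≡⟨ *-identityˡ c ⟩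
      c                                    ∎
      where open ≡-Reasoning

    module _ (γ : Geodesic) (r : ℕ) where

      private
        piece = map proj₁ (pieceTree γ r)

      -- The constant function 1 turns the sum in `∑-piece` into a count.
      ι-length-piece : ι (length piece) ≡ κ ^ r
      ι-length-piece = begin
        ι (length piece)                   ≡⟨ ∑-length piece ⟨
        ∑ piece (λ _ → 1ℚ)                 ≡⟨ ∑-piece γ r (λ _ → 1ℚ) ⟩
        B^ r (λ _ → 1ℚ) (entryDart γ r)    ≡⟨ B^-const r 1ℚ (entryDart γ r) ⟩
        κ ^ r * 1ℚ                         ≡⟨ *-identityʳ (κ ^ r) ⟩
        κ ^ r                              ∎
        where open ≡-Reasoning

      pieceEnumeration : Enumeration (𝓗 γ r)
      pieceEnumeration = record
        { elements   = piece
        ; unique     = piece-unique γ r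
        ; membership = ∈-piece γ r
        ; nonEmpty   = ℕ.≢-nonZero λ L≡0 → <-irrefl (trans (cong ι (sym L≡0)) ι-length-piece)
                         (^-pos (<-≤-trans (from-yes (0ℚ <? 1ℚ)) 1≤κ) r)
        }

      private
        instance
          L≢0 : ℕ.NonZero (length piece)
          L≢0 = nonEmpty pieceEnumeration
        1/L : ℚ
        1/L = ℤ.+ 1 / length piece

      -- `decay` is applied to the composite of `f - m` with `target`, where `m` is the mean of `f`.
      -- The constant `m` contributes κ ^ r `m`, and dividing by the number κ ^ r of vertices leaves
      -- the difference of the averages.
      deviation : ∀ (f : V G → ℚ) {M} → (∀ v → ∣ f v ∣ ≤ M) →
        ∣ ∑ piece (λ x → f (π x)) * 1/L - ∑ vs f * 1/#V ∣ ≤ C * M * β ^ r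
      deviation f {M} f≤M = begin
        ∣ S * 1/L - m ∣                           ≡⟨ cong (λ z → ∣ S * 1/L - z ∣) (trans (cong (_* m) 1/L*κ^r≡1) (*-identityˡ m)) ⟨
        ∣ S * 1/L - 1/L * κ ^ r * m ∣             ≡⟨ cong ∣_∣ (solve 4 (λ S i k m → S :* i :- i :* k :* m := i :* (S :- k :* m)) refl S 1/L (κ ^ r) m) ⟩
        ∣ 1/L * (S - κ ^ r * m) ∣                 ≡⟨ cong (λ z → ∣ 1/L * z ∣) B^h≡ ⟨
        ∣ 1/L * B^ r h d₀ ∣                       ≡⟨ ∣p*q∣≡∣p∣*∣q∣ 1/L (B^ r h d₀) ⟩
        ∣ 1/L ∣ * ∣ B^ r h d₀ ∣                   ≡⟨ cong (_* ∣ B^ r h d₀ ∣) (0≤p⇒∣p∣≡p (0≤1/n (length piece))) ⟩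
        1/L * ∣ B^ r h d₀ ∣                       ≤⟨ *-monoˡ-≤-nonNeg 1/L {{nonNegative (0≤1/n (length piece))}}
                                                       (proj₂ (proj₂ (proj₂ (proj₂ (proj₂ decay)))) r ∑h≡0 (λ d → F≤2M (target G d)) d₀) ⟩
        1/L * (κ ^ r * (C₀ * β ^ r * (M + M)))    ≡⟨ *-assoc 1/L (κ ^ r) (C₀ * β ^ r * (M + M)) ⟨
        1/L * κ ^ r * (C₀ * β ^ r * (M + M))      ≡⟨ cong (_* (C₀ * β ^ r * (M + M))) 1/L*κ^r≡1 ⟩
        1ℚ * (C₀ * β ^ r * (M + M))               ≡⟨ solve 3 (λ c b m → con 1ℚ :* (c :* b :* (m :+ m)) := con (ι 2) :* c :* m :* b) refl C₀ (β ^ r) M ⟩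
        C * M * β ^ r                             ∎
        where
        open ≤-Reasoning
        d₀ = entryDart γ r
        S = ∑ piece (λ x → f (π x))
        m = ∑ vs f * 1/#V
        F : V G → ℚ
        F v = f v - m
        h : Dart G → ℚ
        h d = F (target G d)
        1/L*κ^r≡1 : 1/L * κ ^ r ≡ 1ℚ
        1/L*κ^r≡1 = trans (cong (1/L *_) (sym ι-length-piece)) (1/n*n≡1 (length piece))
        B^h≡ : B^ r h d₀ ≡ S - κ ^ r * m
        B^h≡ = trans (B^-distrib-- r (λ d → f (target G d)) (λ _ → m) d₀)
          (cong₂ _-_ (sym (∑-piece γ r f)) (B^-const r m d₀))
        ∑F≡0 : ∑ vs F ≡ 0ℚ
        ∑F≡0 = begin-equality
          ∑ vs F                                  ≡⟨ ∑-distrib-- vs f (λ _ → m) ⟩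
          ∑ vs f - ∑ vs (λ _ → m)                 ≡⟨ cong (λ z → ∑ vs f - z) (∑-*ˡ vs (∑ vs f) (λ _ → 1/#V)) ⟩
          ∑ vs f - ∑ vs f * ∑ vs (λ _ → 1/#V)     ≡⟨ cong (λ z → ∑ vs f - ∑ vs f * z) ∑1/#V ⟩
          ∑ vs f - ∑ vs f * 1ℚ                    ≡⟨ cong (λ z → ∑ vs f - z) (*-identityʳ (∑ vs f)) ⟩
          ∑ vs f - ∑ vs f                         ≡⟨ +-inverseʳ (∑ vs f) ⟩
          0ℚ                                      ∎
          where
          ∑1/#V : ∑ vs (λ _ → 1/#V) ≡ 1ℚ
          ∑1/#V = trans (∑-cong vs (λ _ → sym (*-identityˡ 1/#V)))
            (trans (∑-*ʳ vs 1/#V (λ _ → 1ℚ)) (∑-const 1ℚ))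
        ∑h≡0 : ∑ (darts G) h ≡ 0ℚ
        ∑h≡0 = trans (∑-target F) (trans (cong ((1ℚ + κ) *_) ∑F≡0) (*-zeroʳ (1ℚ + κ)))
        m≤M : ∣ m ∣ ≤ M
        m≤M = begin
          ∣ ∑ vs f * 1/#V ∣                       ≡⟨ ∣p*q∣≡∣p∣*∣q∣ (∑ vs f) 1/#V ⟩
          ∣ ∑ vs f ∣ * ∣ 1/#V ∣                   ≡⟨ cong (∣ ∑ vs f ∣ *_) (0≤p⇒∣p∣≡p (0≤1/n (#V G))) ⟩
          ∣ ∑ vs f ∣ * 1/#V                       ≤⟨ *-monoʳ-≤-nonNeg 1/#V {{nonNegative (0≤1/n (#V G))}}
                                                       (≤-trans (∣∑∣≤ vs f) (∑-mono vs f≤M)) ⟩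
          ∑ vs (λ _ → M) * 1/#V                   ≡⟨ ∑-const M ⟩
          M                                       ∎
        F≤2M : ∀ v → ∣ F v ∣ ≤ M + M
        F≤2M v = ≤-trans (∣p-q∣≤∣p∣+∣q∣ (f v) m) (+-mono-≤ (f≤M v) m≤M)

      deviationℝ : ∀ (f : V G → ℝ) →
        ∣ average pieceEnumeration (lift f) -ℝ averageV G root f ∣ℝ ≤ℝ fromℚ C *ℝ norm₂ G f *ℝ fromℚ β ^ℝ r
      deviationℝ f {ε} 0<ε = N , λ n n≥ → begin
        ∣ seq (sumℝ (map (lift f) piece)) n * 1/L - seq (sumℝ (map f vs)) n * 1/#V ∣
          ≡⟨ cong₂ (λ s t → ∣ s * 1/L - t * 1/#V ∣) (seq-sumℝ piece (lift f) n) (seq-sumℝ vs f n) ⟩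
        ∣ ∑ piece (λ x → seq (f (π x)) n) * 1/L - ∑ vs (λ v → seq (f v) n) * 1/#V ∣
          ≤⟨ deviation (λ v → seq (f v) n) (values≤ n) ⟩
        C * (lo n + width n) * β ^ r
          ≡⟨ solve 4 (λ c l w b → c :* (l :+ w) :* b := c :* l :* b :+ c :* b :* w) refl C (lo n) (width n) (β ^ r) ⟩
        C * lo n * β ^ r + C * β ^ r * width n
          ≤⟨ +-monoʳ-≤ (C * lo n * β ^ r) (width-small n n≥) ⟩
        C * lo n * β ^ r + ε
          ≡⟨ cong (λ z → C * lo n * z + ε) (seq-^ℝ β r n) ⟨
        C * lo n * seq (fromℚ β ^ℝ r) n + ε ∎
        where
        open ≤-Reasoning
        squares : ℝ
        squares = sumℝ (map (λ v → f v *ℝ f v) vs)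
        a lo width : ℕ → ℚ
        a n = 0ℚ ⊔ seq squares n
        lo n = sqrtLow (a n) n
        width n = sqrtWidth (a n) n
        0≤a : ∀ n → 0ℚ ≤ a n
        0≤a n = p≤p⊔q 0ℚ (seq squares n)
        bound = bounded squares
        b = proj₁ bound
        0<b = proj₁ (proj₂ bound)
        N₁ = proj₁ (proj₂ (proj₂ bound))
        small = ½^-small (C * β ^ r * (1ℚ + b)) 0<ε
        -- From `N₁` on the sum of squares stays below `b`, so `width n` is at most (1 + `b`)
        -- `½^ n`; the second index makes its multiple by `C * β ^ r` smaller than ε.
        N = N₁ ℕ.⊔ proj₁ small
        0≤C*β^r : 0ℚ ≤ C * β ^ r
        0≤C*β^r = *-nonNeg (<⇒≤ 0<C) (^-nonNeg 0≤β r)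
        -- The maximum is at most the 2-norm: one square is at most the sum of squares, and the
        -- upper end of the bisection interval has a larger square.
        values≤ : ∀ n v → ∣ seq (f v) n ∣ ≤ lo n + width n
        values≤ n v = square-cancel-≤ (+-mono-≤ (proj₁ (sqrt-bracket (0≤a n) n)) (sqrtWidth-nonNeg (0≤a n) n)) (begin
          ∣ seq (f v) n ∣ * ∣ seq (f v) n ∣           ≡⟨ ∣p∣*∣p∣≡p*p (seq (f v) n) ⟩
          seq (f v) n * seq (f v) n                   ≤⟨ term≤∑ (λ v → 0≤p*p (seq (f v) n)) (∈-allFin v) ⟩
          ∑ vs (λ v → seq (f v) n * seq (f v) n)      ≡⟨ seq-sumℝ vs (λ v → f v *ℝ f v) n ⟨
          seq squares n                               ≤⟨ p≤q⊔p 0ℚ (seq squares n) ⟩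
          a n                                         ≤⟨ <⇒≤ (proj₂ (proj₂ (sqrt-bracket (0≤a n) n))) ⟩
          (lo n + width n) * (lo n + width n)         ∎)
        width-small : ∀ n → N ℕ.≤ n → C * β ^ r * width n ≤ ε
        width-small n n≥ = begin
          C * β ^ r * ((1ℚ + a n) * ½^ n)     ≡⟨ *-assoc (C * β ^ r) (1ℚ + a n) (½^ n) ⟨
          C * β ^ r * (1ℚ + a n) * ½^ n       ≤⟨ *-monoʳ-≤-nonNeg (½^ n) {{nonNegative (½^-nonNeg n)}}
                                                   (*-monoˡ-≤-nonNeg (C * β ^ r) {{nonNegative 0≤C*β^r}} (+-monoʳ-≤ 1ℚ a≤b)) ⟩
          C * β ^ r * (1ℚ + b) * ½^ n         ≤⟨ <⇒≤ (proj₂ small n (ℕ.m⊔n≤o⇒n≤o N₁ (proj₁ small) n≥)) ⟩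
          ε                                   ∎
          where
          a≤b : a n ≤ b
          a≤b = ⊔-lub (<⇒≤ 0<b) (≤-trans (p≤∣p∣ (seq squares n))
            (<⇒≤ (proj₂ (proj₂ (proj₂ bound)) n (ℕ.m⊔n≤o⇒m≤o N₁ (proj₁ small) n≥))))

  -- ¾ exceeds √(1/q) since q ≥ 2.
  √1/q≤β : (√ (_÷ℝ_ 1ℝ q {{3≤q+1⇒nonZero 3≤q+1}})) ≤ℝ fromℚ β
  √1/q≤β {ε} 0<ε = 0 , λ n _ → ≤-trans (sqrtLow≤¾ (p≤p⊔q 0ℚ (1ℚ * 1/q)) (⊔-lub (from-yes (0ℚ ≤? ½)) 1/q≤½) n)
    (≤-trans ¾≤β (subst (_≤ β + ε) (+-identityʳ β) (+-monoʳ-≤ β (<⇒≤ 0<ε))))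
    where
    open ≤-Reasoning
    instance
      q≢0 : ℕ.NonZero q
      q≢0 = 3≤q+1⇒nonZero 3≤q+1
    1/q : ℚ
    1/q = ℤ.+ 1 / q
    1/q≤½ : 1ℚ * 1/q ≤ ½
    1/q≤½ = begin
      1ℚ * 1/q                  ≡⟨ solve 1 (λ i → con 1ℚ :* i := con ½ :* (i :* con (ι 2))) refl 1/q ⟩
      ½ * (1/q * ι 2)           ≤⟨ *-monoˡ-≤-nonNeg ½ (*-monoˡ-≤-nonNeg 1/q {{nonNegative (0≤1/n q)}}
                                     (ι-mono {2} {q} (ℕ.+-cancelʳ-≤ 1 2 q 3≤q+1))) ⟩
      ½ * (1/q * κ)             ≡⟨ cong (½ *_) (1/n*n≡1 q) ⟩
      ½ * 1ℚ                    ≡⟨⟩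
      ½                         ∎

  fromℚ-β<1 : fromℚ β <ℝ 1ℝ
  fromℚ-β<1 = 1ℚ - β , subst (_< 1ℚ - β) (+-inverseʳ β) (+-monoˡ-< (- β) β<1) ,
    0 , λ _ _ → ≤-reflexive (solve 1 (λ b → b :+ (con 1ℚ :- b) := con 1ℚ) refl β)

  0<fromℚ-C : 0ℝ <ℝ fromℚ C
  0<fromℚ-C = C , 0<C , 0 , λ _ _ → ≤-reflexive (+-identityˡ C)

open import Data.Nat using (_+_; _≤_)
open import Data.Product using (Σ-syntax; ∃-syntax)

theorem4 : (G : Graph) → Connected G → ¬ Bipartite G →
    (q : ℕ) (3≤q+1 : 3 ≤ q + 1) → Regular G (q + 1) →
    ∃[ C ] ∃[ β ] 0ℝ <ℝ C × (√ (_÷ℝ_ 1ℝ q {{3≤q+1⇒nonZero 3≤q+1}})) ≤ℝ β × β <ℝ 1ℝ ×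
    ((root : V G) → let open UniversalCover G root in
    (f : V G → ℝ) (γ : Geodesic) (r : ℕ) →
    Σ[ H ∈ Enumeration (𝓗 γ r) ]
    ∣ average H (lift f) -ℝ averageV G root f ∣ℝ ≤ℝ C *ℝ norm₂ G f *ℝ β ^ℝ r)
-- Both constants are rational and are fixed before the root, the function, the geodesic and the
-- radius.
theorem4 G connected ¬bipartite q 3≤q+1 regular =
  fromℚ C , fromℚ β , 0<fromℚ-C , √1/q≤β , fromℚ-β<1 ,
  λ root f γ r → pieceEnumeration root γ r , deviationℝ root γ r f
  where
  open HorocycleAverages G connected ¬bipartite q 3≤q+1 regular
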